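{- Every treelike snark is frumious.
   Context: Graphs may contain parallel edges but no loops; bridgeless means $2$-edge-connected. A multigraph is Class I if its chromatic index equals its maximum degree. For a perfect matching $M$ of $G$ and an integer $t\ge 0$, $G+tM$ is the multigraph obtained from $G$ by adding $t$ parallel edges to every edge of $M$. $l_M(G)$ is the minimum $t\ge 0$ such that $G+tM$ is Class I, and $l_M(G)=+\infty$ if no such $t$ exists. A bridgeless cubic graph $G$ is frumious if $l_M(G)=+\infty$ for all perfect matchings $M$ of $G$. A snark is a bridgeless cubic graph with chromatic index $4$ (every frumious graph is a snark). A dangling edge is an edge having exactly one end-vertex. A $4$-pole is what is obtained from a vertex subset $U$ of a cubic graph with exactly four edges leaving $U$, by taking the subgraph induced by $U$ together with these four edges as dangling edges (so each vertex has degree $3$, counting dangling edges). Joining a dangling edge with end-vertex $x$ to a vertex $y$ means deleting the dangling edge and making $x$ and $y$ adjacent. Let $A$ be a $4$-pole whose four dangling edges are partitioned into ordered pairs $(l_1,l_2)$ (first and second left dangling edges) and $(r_1,r_2)$ (first and second right dangling edges), and let $u_1,u_2,v_1,v_2$ be the end-vertices of $l_1,l_2,r_1,r_2$, respectively. $A$ is frumious (with respect to this partition) if the graph obtained by removing the four dangling edges and adding two new vertices $u,v$, with $u$ adjacent to $v,u_1,u_2$ and $v$ adjacent to $u,v_1,v_2$, is a frumious snark. A Halin graph is a plane graph consisting of a planar representation of a tree without degree $2$ vertices and a circuit on the set of its leaves. Let $H$ be a cubic Halin graph consisting of the tree $T$ and the circuit $K$. A treelike snark is any cubic graph that can be obtained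 as follows: start from $T$; for every leaf $x$ of $T$ add two new vertices $x_1,x_2$ and the edges $xx_1,xx_2$; for every edge $xy$ of $K$, with $x$ the predecessor of $y$ in the clockwise orientation of $K$, replace the edge $xy$ with a frumious $4$-pole (possibly different ones for different edges), joining its first and second left dangling edges to $x_1$ and $x_2$, respectively, and its first and second right dangling edges to $y_1$ and $y_2$, respectively. -}

module Defs where

open import Data.Bool using (Bool; true; false; T)
open import Data.Fin using (Fin; zero; suc)
open import Data.Fin.Properties using (+↔⊎; *↔×; 0↔⊥; 1↔⊤)
open import Data.Maybe using (Maybe; just; nothing; maybe′)
open import Data.Maybe.Properties using (just-injective)
open import Data.Nat using (ℕ; zero; suc; _≤_)
open import Data.Product using (Σ; ∃; ∃!; Σ-syntax; _×_; _,_; proj₁; proj₂)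
open import Data.Product.Function.Dependent.Propositional using (Σ-↔)
open import Data.Product.Function.NonDependent.Propositional using (_×-cong_)
open import Data.Sum using (_⊎_; inj₁; inj₂)
open import Data.Sum.Function.Propositional using (_⊎-cong_)
open import Data.Unit using (⊤; tt)
open import Function using (_∘_)
open import Function.Bundles using (_↔_; mk↔ₛ′; Inverse)
open import Function.Properties.Inverse using (↔-refl; ↔-sym; ↔-trans)
open import Relation.Binary.Construct.Closure.ReflexiveTransitive using (Star)
open import Relation.Binary.PropositionalEquality using (_≡_; _≢_; refl)
open import Relation.Nullary using (¬_)

------------------------------------------------------------------------
-- Finite types

Finite : Set → Set
Finite A = ∃ λ n → A ↔ Fin n

finite-↔ : ∀ {A B} → A ↔ B → Finite B → Finite A
finite-↔ i (n , j) = n , ↔-trans i j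

finite-Fin : ∀ n → Finite (Fin n)
finite-Fin n = n , ↔-refl

finite-⊤ : Finite ⊤
finite-⊤ = 1 , ↔-sym 1↔⊤

finite-⊎ : ∀ {A B} → Finite A → Finite B → Finite (A ⊎ B)
finite-⊎ (_ , i) (_ , j) = _ , ↔-trans (i ⊎-cong j) (↔-sym +↔⊎)

finite-× : ∀ {A B} → Finite A → Finite B → Finite (A × B)
finite-× (_ , i) (_ , j) = _ , ↔-trans (i ×-cong j) (↔-sym *↔×)

finite-T : ∀ b → Finite (T b)
finite-T true  = finite-⊤
finite-T false = 0 , ↔-sym 0↔⊥

finite-ΣFin : ∀ n {B : Fin n → Set} → (∀ i → Finite (B i)) → Finite (Σ (Fin n) B)
finite-ΣFin zero    _ = 0 , mk↔ₛ′ (λ ()) (λ ()) (λ ()) (λ ())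
finite-ΣFin (suc n) {B} f =
  finite-↔ split (finite-⊎ (f zero) (finite-ΣFin n (f ∘ suc)))
  where
  split : Σ (Fin (suc n)) B ↔ (B zero ⊎ Σ (Fin n) (B ∘ suc))
  split = mk↔ₛ′
    (λ { (zero , b) → inj₁ b ; (suc i , b) → inj₂ (i , b) })
    (λ { (inj₁ b) → zero , b ; (inj₂ (i , b)) → suc i , b })
    (λ { (inj₁ _) → refl ; (inj₂ _) → refl })
    (λ { (zero , _) → refl ; (suc _ , _) → refl })

finite-Σ : ∀ {A} {B : A → Set} → Finite A → (∀ a → Finite (B a)) → Finite (Σ A B)
finite-Σ (n , i) f =
  finite-↔ (↔-sym (Σ-↔ (↔-sym i) ↔-refl)) (finite-ΣFin n (f ∘ Inverse.from i))

------------------------------------------------------------------------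
-- Finite loopless multigraphs

-- The two components of `ends e` are in no significant order.
record Graph : Set₁ where
  field
    Vertex       : Set
    Edge         : Set
    ends         : Edge → Vertex × Vertex
    loopless     : ∀ e → proj₁ (ends e) ≢ proj₂ (ends e)
    finiteVertex : Finite Vertex
    finiteEdge   : Finite Edge

  Incident : Vertex → Edge → Set
  Incident v e = v ≡ proj₁ (ends e) ⊎ v ≡ proj₂ (ends e)

  Joins : Edge → Vertex → Vertex → Set
  Joins e u v = ends e ≡ (u , v) ⊎ ends e ≡ (v , u)

open Graph

record _≅_ (G H : Graph) : Set where
  field
    vertices : Vertex G ↔ Vertex H
    edges    : Edge G ↔ Edge H
    joins    : ∀ e u v → Joins G e u v →
               Joins H (Inverse.to edges e) (Inverse.to vertices u) (Inverse.to vertices v)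

HasDegree : (G : Graph) → Vertex G → ℕ → Set
HasDegree G v d = (Σ[ e ∈ Edge G ] Incident G v e) ↔ Fin d

Cubic : Graph → Set
Cubic G = ∀ v → HasDegree G v 3

-- `P` selects the edges that may be used.
ConnectedVia : (G : Graph) → (Edge G → Set) → Set
ConnectedVia G P = ∀ u v → Star (λ x y → Σ[ e ∈ Edge G ] P e × Joins G e x y) u v

Connected : Graph → Set
Connected G = ConnectedVia G (λ _ → ⊤)

-- 2-edge-connectedness
Bridgeless : Graph → Set
Bridgeless G = Connected G × (∀ e → ConnectedVia G (_≢ e))

------------------------------------------------------------------------
-- Edge colourings, perfect matchings, snarks

Proper : (G : Graph) {k : ℕ} → (Edge G → Fin k) → Set
Proper G c = ∀ v e f → Incident G v e → Incident G v f → c e ≡ c f → e ≡ f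

EdgeColourable : Graph → ℕ → Set
EdgeColourable G k = Σ[ c ∈ (Edge G → Fin k) ] Proper G c

IsChromaticIndex : Graph → ℕ → Set
IsChromaticIndex G k = EdgeColourable G k × (∀ j → EdgeColourable G j → k ≤ j)

IsMaxDegree : Graph → ℕ → Set
IsMaxDegree G k = (∃ λ v → HasDegree G v k) × (∀ v d → HasDegree G v d → d ≤ k)

ClassI : Graph → Set
ClassI G = ∃ λ k → IsMaxDegree G k × IsChromaticIndex G k

EdgeSet : Graph → Set
EdgeSet G = Edge G → Bool

PerfectMatching : (G : Graph) → EdgeSet G → Set
PerfectMatching G M = ∀ v → ∃! _≡_ λ e → T (M e) × Incident G v e

-- G ⊕ t · M is the multigraph G + tM.
_⊕_·_ : (G : Graph) → ℕ → EdgeSet G → Graph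
G ⊕ t · M = record
  { Vertex       = Vertex G
  ; Edge         = Edge G ⊎ (Σ[ e ∈ Edge G ] T (M e)) × Fin t
  ; ends         = λ { (inj₁ e) → ends G e ; (inj₂ ((e , _) , _)) → ends G e }
  ; loopless     = λ { (inj₁ e) → loopless G e ; (inj₂ ((e , _) , _)) → loopless G e }
  ; finiteVertex = finiteVertex G
  ; finiteEdge   =
      finite-⊎ (finiteEdge G)
        (finite-× (finite-Σ (finiteEdge G) (finite-T ∘ M)) (finite-Fin t))
  }

-- l_M(G) = +∞
l≡∞ : (G : Graph) → EdgeSet G → Set
l≡∞ G M = ∀ t → ¬ ClassI (G ⊕ t · M)

Frumious : Graph → Set
Frumious G = Bridgeless G × Cubic G × (∀ M → PerfectMatching G M → l≡∞ G M)

Snark : Graph → Set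
Snark G = Bridgeless G × Cubic G × IsChromaticIndex G 4

------------------------------------------------------------------------
-- 4-poles

data Side : Set where
  left right : Side

finite-Side : Finite Side
finite-Side = 2 , mk↔ₛ′
  (λ { left → zero ; right → suc zero })
  (λ { zero → left ; (suc zero) → right })
  (λ { zero → refl ; (suc zero) → refl })
  (λ { left → refl ; right → refl })

-- The dangling edges are indexed by Side × Fin 2: the pairs (left , 0),
-- (left , 1), (right , 0), (right , 1) stand for l₁, l₂, r₁, r₂, and
-- `end` gives their end-vertices u₁, u₂, v₁, v₂, which need not be distinct.
record FourPole : Set₁ where
  field
    graph : Graph
    end   : Side → Fin 2 → Vertex graph
    cubic : ∀ w → ((Σ[ e ∈ Edge graph ] Incident graph w e) ⊎
                   (Σ[ s ∈ Side ] Σ[ j ∈ Fin 2 ] w ≡ end s j)) ↔ Fin 3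

open FourPole

module _ (A : FourPole) where

  -- `apex left` and `apex right` are the new vertices u and v.
  data ClosureVertex : Set where
    old  : Vertex (graph A) → ClosureVertex
    apex : Side → ClosureVertex

  data ClosureEdge : Set where
    old  : Edge (graph A) → ClosureEdge
    join : Side → Fin 2 → ClosureEdge
    uv   : ClosureEdge

  closure : Graph
  closure = record
    { Vertex       = ClosureVertex
    ; Edge         = ClosureEdge
    ; ends         = λ { (old e)    → old (proj₁ (ends (graph A) e)) , old (proj₂ (ends (graph A) e))
                       ; (join s j) → apex s , old (end A s j)
                       ; uv         → apex left , apex right }
    ; loopless     = λ { (old e) eq → loopless (graph A) e (old-injective eq)
                       ; (join _ _) () ; uv () }
    ; finiteVertex = finite-↔ vertexSum (finite-⊎ (finiteVertex (graph A)) finite-Side)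
    ; finiteEdge   = finite-↔ edgeSum
        (finite-⊎ (finiteEdge (graph A)) (finite-⊎ (finite-× finite-Side (finite-Fin 2)) finite-⊤))
    }
    where
    old-injective : ∀ {x y} → ClosureVertex.old x ≡ old y → x ≡ y
    old-injective refl = refl

    vertexSum : ClosureVertex ↔ (Vertex (graph A) ⊎ Side)
    vertexSum = mk↔ₛ′
      (λ { (old x) → inj₁ x ; (apex s) → inj₂ s })
      (λ { (inj₁ x) → old x ; (inj₂ s) → apex s })
      (λ { (inj₁ _) → refl ; (inj₂ _) → refl })
      (λ { (old _) → refl ; (apex _) → refl })

    edgeSum : ClosureEdge ↔ (Edge (graph A) ⊎ (Side × Fin 2) ⊎ ⊤)
    edgeSum = mk↔ₛ′
      (λ { (old e) → inj₁ e ; (join s j) → inj₂ (inj₁ (s , j)) ; uv → inj₂ (inj₂ tt) })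
      (λ { (inj₁ e) → old e ; (inj₂ (inj₁ (s , j))) → join s j ; (inj₂ (inj₂ _)) → uv })
      (λ { (inj₁ _) → refl ; (inj₂ (inj₁ _)) → refl ; (inj₂ (inj₂ _)) → refl })
      (λ { (old _) → refl ; (join _ _) → refl ; uv → refl })

FrumiousPole : FourPole → Set
FrumiousPole A = Frumious (closure A) × Snark (closure A)

------------------------------------------------------------------------
-- Cubic Halin graphs

-- A part of a plane tree hanging from an edge, every vertex having degree
-- 1 or 3.  At the top vertex of `fork a b`, the clockwise order of the three
-- edges is: the edge it hangs from, the edge to a, the edge to b.
data Branch : Set where
  leaf : Branch
  fork : Branch → Branch → Branch

data Node : Branch → Set where
  top : ∀ {b} → Node b
  inˡ : ∀ {a b} → Node a → Node (fork a b)
  inʳ : ∀ {a b} → Node b → Node (fork a b)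

parent : ∀ {b} → Node b → Maybe (Node b)
parent top     = nothing
parent (inˡ p) = just (maybe′ inˡ top (parent p))
parent (inʳ p) = just (maybe′ inʳ top (parent p))

data Tip : Branch → Set where
  tip : Tip leaf
  inˡ : ∀ {a b} → Tip a → Tip (fork a b)
  inʳ : ∀ {a b} → Tip b → Tip (fork a b)

tipNode : ∀ {b} → Tip b → Node b
tipNode tip     = top
tipNode (inˡ x) = inˡ (tipNode x)
tipNode (inʳ x) = inʳ (tipNode x)

firstTip : ∀ b → Tip b
firstTip leaf       = tip
firstTip (fork a _) = inˡ (firstTip a)

nextTip : ∀ {b} → Tip b → Maybe (Tip b)
nextTip tip                 = nothing
nextTip (inˡ {a} {b} x)     = just (maybe′ inˡ (inʳ (firstTip b)) (nextTip x))
nextTip (inʳ x)             = maybe′ (just ∘ inʳ) nothing (nextTip x)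

-- A cubic Halin graph is given by the planar representation of its tree T, as
-- an ordered tree: every leaf of T has degree 1 and every other vertex degree
-- 3, T is rooted at one of the latter, and `branch` lists the branches at the
-- root in clockwise order.  (T is not a single edge: Halin graphs are simple, so
-- their circuit has at least three vertices.)  The circuit K is then
-- determined: in order not to cross T it has to run through the leaves in the
-- order in which they occur around T.
record CubicHalin : Set where
  field
    branch : Fin 3 → Branch

open CubicHalin

module _ (H : CubicHalin) where

  data TreeVertex : Set where
    root  : TreeVertex
    below : (i : Fin 3) → Node (branch H i) → TreeVertex

  -- (i , p) is the edge from `below i p` to its parent.
  TreeEdge : Set
  TreeEdge = Σ[ i ∈ Fin 3 ] Node (branch H i)

  treeEnds : TreeEdge → TreeVertex × TreeVertex
  treeEnds (i , p) = below i p , maybe′ (below i) root (parent p)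

  Leaf : Set
  Leaf = Σ[ i ∈ Fin 3 ] Tip (branch H i)

  leafVertex : Leaf → TreeVertex
  leafVertex (i , x) = below i (tipNode x)

  nextBranch : Fin 3 → Fin 3
  nextBranch zero             = suc zero
  nextBranch (suc zero)       = suc (suc zero)
  nextBranch (suc (suc zero)) = zero

  -- The edges of K are those joining x to `successor x`, for x a leaf, and x
  -- is the predecessor of `successor x` in the clockwise orientation of K.
  successor : Leaf → Leaf
  successor (i , x) =
    maybe′ (i ,_) (nextBranch i , firstTip (branch H (nextBranch i))) (nextTip x)

parent-irreflexive : ∀ {b} (p : Node b) → parent p ≢ just p
parent-irreflexive (inˡ p) eq with parent p in q | just-injective eq
... | just _ | refl = parent-irreflexive p q
parent-irreflexive (inʳ p) eq with parent p in q | just-injective eq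
... | just _ | refl = parent-irreflexive p q

finite-Node : ∀ b → Finite (Node b)
finite-Node leaf = finite-↔
  (mk↔ₛ′ (λ _ → tt) (λ _ → top) (λ _ → refl) (λ { top → refl })) finite-⊤
finite-Node (fork a b) = finite-↔
  (mk↔ₛ′
    (λ { top → inj₁ tt ; (inˡ p) → inj₂ (inj₁ p) ; (inʳ p) → inj₂ (inj₂ p) })
    (λ { (inj₁ _) → top ; (inj₂ (inj₁ p)) → inˡ p ; (inj₂ (inj₂ p)) → inʳ p })
    (λ { (inj₁ _) → refl ; (inj₂ (inj₁ _)) → refl ; (inj₂ (inj₂ _)) → refl })
    (λ { top → refl ; (inˡ _) → refl ; (inʳ _) → refl }))
  (finite-⊎ finite-⊤ (finite-⊎ (finite-Node a) (finite-Node b)))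

finite-Tip : ∀ b → Finite (Tip b)
finite-Tip leaf = finite-↔
  (mk↔ₛ′ (λ _ → tt) (λ _ → tip) (λ _ → refl) (λ { tip → refl })) finite-⊤
finite-Tip (fork a b) = finite-↔
  (mk↔ₛ′
    (λ { (inˡ x) → inj₁ x ; (inʳ x) → inj₂ x })
    (λ { (inj₁ x) → inˡ x ; (inj₂ x) → inʳ x })
    (λ { (inj₁ _) → refl ; (inj₂ _) → refl })
    (λ { (inˡ _) → refl ; (inʳ _) → refl }))
  (finite-⊎ (finite-Tip a) (finite-Tip b))

------------------------------------------------------------------------
-- Treelike snarks

-- `A x` replaces the edge of K from x to `successor H x`.
module _ (H : CubicHalin) (A : Leaf H → FourPole) where

  -- `twin x 0` and `twin x 1` are the new vertices x₁ and x₂.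
  data TreelikeVertex : Set where
    tree : TreeVertex H → TreelikeVertex
    twin : Leaf H → Fin 2 → TreelikeVertex
    pole : (x : Leaf H) → Vertex (graph (A x)) → TreelikeVertex

  data TreelikeEdge : Set where
    tree : TreeEdge H → TreelikeEdge
    twin : Leaf H → Fin 2 → TreelikeEdge
    pole : (x : Leaf H) → Edge (graph (A x)) → TreelikeEdge
    join : Leaf H → Side → Fin 2 → TreelikeEdge

  circuitEnd : Leaf H → Side → Leaf H
  circuitEnd x left  = x
  circuitEnd x right = successor H x

  treelikeEnds : TreelikeEdge → TreelikeVertex × TreelikeVertex
  treelikeEnds (tree e)     = tree (proj₁ (treeEnds H e)) , tree (proj₂ (treeEnds H e))
  treelikeEnds (twin x j)   = tree (leafVertex H x) , twin x j
  treelikeEnds (pole x e)   = pole x (proj₁ (ends (graph (A x)) e)) , pole x (proj₂ (ends (graph (A x)) e))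
  treelikeEnds (join x s j) = pole x (end (A x) s j) , twin (circuitEnd x s) j

  treelike : Graph
  treelike = record
    { Vertex       = TreelikeVertex
    ; Edge         = TreelikeEdge
    ; ends         = treelikeEnds
    ; loopless     = noLoop
    ; finiteVertex = finite-↔ vertexSum
        (finite-⊎ (finite-⊎ finite-⊤ finite-TreeEdge)
          (finite-⊎ (finite-× finite-Leaf (finite-Fin 2))
            (finite-Σ finite-Leaf (λ x → finiteVertex (graph (A x))))))
    ; finiteEdge   = finite-↔ edgeSum
        (finite-⊎ finite-TreeEdge
          (finite-⊎ (finite-× finite-Leaf (finite-Fin 2))
            (finite-⊎ (finite-Σ finite-Leaf (λ x → finiteEdge (graph (A x))))
              (finite-× finite-Leaf (finite-× finite-Side (finite-Fin 2))))))
    }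
    where
    finite-TreeEdge : Finite (TreeEdge H)
    finite-TreeEdge = finite-Σ (finite-Fin 3) (finite-Node ∘ branch H)

    finite-Leaf : Finite (Leaf H)
    finite-Leaf = finite-Σ (finite-Fin 3) (finite-Tip ∘ branch H)

    tree-injective : ∀ {x y} → TreelikeVertex.tree x ≡ tree y → x ≡ y
    tree-injective refl = refl

    pole-injective : ∀ {x y z} → TreelikeVertex.pole x y ≡ pole x z → y ≡ z
    pole-injective refl = refl

    noTreeLoop : ∀ i (p : Node (branch H i)) → below i p ≢ maybe′ (below {H} i) root (parent p)
    noTreeLoop i p eq with parent p in q
    noTreeLoop i p refl | just _ = parent-irreflexive p q

    noLoop : ∀ e → proj₁ (treelikeEnds e) ≢ proj₂ (treelikeEnds e)
    noLoop (tree (i , p)) eq = noTreeLoop i p (tree-injective eq)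
    noLoop (pole x e)     eq = loopless (graph (A x)) e (pole-injective eq)

    vertexSum : TreelikeVertex ↔ ((⊤ ⊎ TreeEdge H) ⊎ (Leaf H × Fin 2) ⊎ (Σ[ x ∈ Leaf H ] Vertex (graph (A x))))
    vertexSum = mk↔ₛ′
      (λ { (tree root) → inj₁ (inj₁ tt) ; (tree (below i p)) → inj₁ (inj₂ (i , p))
         ; (twin x j) → inj₂ (inj₁ (x , j)) ; (pole x w) → inj₂ (inj₂ (x , w)) })
      (λ { (inj₁ (inj₁ _)) → tree root ; (inj₁ (inj₂ (i , p))) → tree (below i p)
         ; (inj₂ (inj₁ (x , j))) → twin x j ; (inj₂ (inj₂ (x , w))) → pole x w })
      (λ { (inj₁ (inj₁ _)) → refl ; (inj₁ (inj₂ _)) → refl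
         ; (inj₂ (inj₁ _)) → refl ; (inj₂ (inj₂ _)) → refl })
      (λ { (tree root) → refl ; (tree (below _ _)) → refl
         ; (twin _ _) → refl ; (pole _ _) → refl })

    edgeSum : TreelikeEdge ↔ (TreeEdge H ⊎ (Leaf H × Fin 2) ⊎ (Σ[ x ∈ Leaf H ] Edge (graph (A x))) ⊎ (Leaf H × Side × Fin 2))
    edgeSum = mk↔ₛ′
      (λ { (tree e) → inj₁ e ; (twin x j) → inj₂ (inj₁ (x , j))
         ; (pole x e) → inj₂ (inj₂ (inj₁ (x , e))) ; (join x s j) → inj₂ (inj₂ (inj₂ (x , s , j))) })
      (λ { (inj₁ e) → tree e ; (inj₂ (inj₁ (x , j))) → twin x j
         ; (inj₂ (inj₂ (inj₁ (x , e)))) → pole x e ; (inj₂ (inj₂ (inj₂ (x , s , j)))) → join x s j })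
      (λ { (inj₁ _) → refl ; (inj₂ (inj₁ _)) → refl
         ; (inj₂ (inj₂ (inj₁ _))) → refl ; (inj₂ (inj₂ (inj₂ _))) → refl })
      (λ { (tree _) → refl ; (twin _ _) → refl ; (pole _ _) → refl ; (join _ _ _) → refl })

record TreelikeSnark (G : Graph) : Set₁ where
  field
    cubic    : Cubic G
    halin    : CubicHalin
    poles    : Leaf halin → FourPole
    frumious : ∀ x → FrumiousPole (poles x)
    iso      : G ≅ treelike halin poles

{-# OPTIONS --safe #-}

-- A (3 + t)-edge-colouring of G + tM assigns to every edge of the cubic graph
-- G the set of colours of its copies: one colour off M, and t + 1 on M.
-- For every colour the edges carrying it form a perfect matching, and so does
-- M; in particular they meet every vertex an odd number of times.
--
-- Let f be such an odd function on the edges of a treelike graph.  By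
-- counting modulo 2, f has the same sum, f(p), over the left and over the
-- right pair of dangling edges of a pole p, and then f(e) = 1 + f(p) + f(q)
-- for the tree edge e that separates the circuit at the poles p and q.
-- A colouring extends over the edge uv of the closure of p as soon as
-- 1 + f(p), for f ranging over the colours and M, is a legitimate value for
-- uv and M contains neither the whole left nor the whole right pair; in the
-- frumious case this never happens.
--
-- Suppose that M contains no dangling edge of some pole p.  As the colouring
-- does not extend, the two left dangling edges have the same colour, so
-- f(p) = 0 for every colour.  Two tree edges that meet separate the circuit at
-- p and another pole, and one of them is not in M.  If it does so at p and q,
-- then it has the colours 1 + f(q), hence the colouring extends over the closure
-- of q, a contradiction.
--
-- So M contains a dangling edge of every pole.  Then "M contains no left
-- dangling edge" passes from a pole to its successor, and "M contains both left
-- dangling edges" to its predecessor.  Hence M(p) = 0 for all p if it holds for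
-- one p.  But a tree edge outside M separates the circuit at two poles
-- with different values of M.
module Submission where

open import Defs

open import Algebra.Bundles using (CommutativeRing)
open import Data.Bool using (Bool; true; false; T; not; _∧_; _xor_)
open import Data.Bool.Properties using (T-≡; T-irrelevant; xor-∧-commutativeRing; xor-same; ∧-zeroʳ; ∧-identityʳ; ∧-distribˡ-xor)
open import Data.Bool.Solver using (module xor-∧-Solver)
open import Data.Empty using (⊥; ⊥-elim)
open import Data.Fin using (Fin; zero; suc; punchIn; punchOut)
open import Data.Fin.Permutation using (↔⇒≡)
open import Data.Fin.Properties using (+↔⊎; any?; injective⇒≤; punchOut-injective; punchIn-injective; punchInᵢ≢i; punchIn-punchOut) renaming (_≟_ to _≟ᶠ_)
open import Data.Maybe using (just; nothing; maybe′)
open import Data.Nat using (ℕ; zero; suc; _+_)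
open import Data.Nat.Properties using (1+n≰n; ≤-reflexive)
open import Data.Product using (∃; ∃!; Σ-syntax; _×_; _,_; proj₁; proj₂)
open import Data.Sum using (_⊎_; inj₁; inj₂; [_,_]′)
open import Data.Sum.Function.Propositional using (_⊎-cong_)
open import Data.Unit using (⊤; tt)
open import Function using (_∘_; id)
open import Function.Bundles using (_↔_; mk↔ₛ′; Inverse; Equivalence)
open import Function.Definitions using (Injective)
open import Function.Properties.Inverse using (↔⇒↣; ↔-refl; ↔-sym; ↔-trans)
open import Relation.Binary using (DecidableEquality)
open import Relation.Binary.Construct.Closure.ReflexiveTransitive using (Star; ε; _◅_; _◅◅_; gmap; kleisliStar; reverse)
open import Relation.Binary.PropositionalEquality
open import Relation.Nullary using (Dec; yes; no; does; ¬_; contradiction)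
open import Relation.Nullary.Decidable using (via-injection; map′; dec-true; dec-false; _×-dec_; toSum)

open import Algebra.Properties.CommutativeMonoid.Sum
  (CommutativeRing.+-commutativeMonoid xor-∧-commutativeRing)
  using (sum; sum-remove; sum-replicate-zero; sum-cong-≗; ∑-distrib-+; ∑-comm)

open Graph
open FourPole using (graph; end)
open CubicHalin

-- Finite sums modulo 2

opaque

  finite⇒≟ : ∀ {A} → Finite A → DecidableEquality A
  finite⇒≟ (_ , i) = via-injection (↔⇒↣ i) _≟ᶠ_

finite-any? : ∀ {A} {P : A → Set} → Finite A → (∀ a → Dec (P a)) → Dec (∃ P)
finite-any? {P = P} (_ , i) P? = map′
  (λ (k , p) → Inverse.from i k , p)
  (λ (a , p) → Inverse.to i a , subst P (sym (Inverse.strictlyInverseʳ i a)) p)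
  (any? (P? ∘ Inverse.from i))

-- Pigeonhole: if `j` were missed, punching it out of the codomain would inject `Fin (suc n)` into
-- `Fin n`.
injective⇒hits : ∀ {n} {f : Fin n → Fin n} → Injective _≡_ _≡_ f → ∀ j → ∃ λ i → f i ≡ j
injective⇒hits {suc n} {f} inj j with any? (λ i → f i ≟ᶠ j)
... | yes hit = hit
... | no miss = contradiction (injective⇒≤ {f = λ i → punchOut (j≢f i)} punched-injective) 1+n≰n
  where
  j≢f : ∀ i → j ≢ f i
  j≢f i eq = miss (i , sym eq)
  punched-injective : Injective _≡_ _≡_ (λ i → punchOut (j≢f i))
  punched-injective eq = inj (punchOut-injective (j≢f _) (j≢f _) eq)

opaque

  ∑ : ∀ {A} → Finite A → (A → Bool) → Bool
  ∑ (_ , i) f = sum (f ∘ Inverse.from i)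

module _ {A : Set} (F : Finite A) where

  opaque
    unfolding ∑

    ∑-cong : ∀ {f g : A → Bool} → (∀ a → f a ≡ g a) → ∑ F f ≡ ∑ F g
    ∑-cong eq = sum-cong-≗ (λ k → eq (Inverse.from (proj₂ F) k))

    ∑-xor : ∀ (f g : A → Bool) → ∑ F (λ a → f a xor g a) ≡ ∑ F f xor ∑ F g
    ∑-xor f g = ∑-distrib-+ (f ∘ Inverse.from (proj₂ F)) (g ∘ Inverse.from (proj₂ F))

    ∑-false : ∑ F (λ _ → false) ≡ false
    ∑-false = sum-replicate-zero (proj₁ F)

    ∑-only : ∀ (f : A → Bool) a → (∀ b → b ≢ a → f b ≡ false) → ∑ F f ≡ f a
    ∑-only f a vanish = go F refl
      where
      go : ∀ F′ → F′ ≡ F → ∑ F′ f ≡ f a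
      -- The empty enumeration is refuted by `a` itself; otherwise the term at the index of `a` is
      -- split off and all others vanish.
      go (zero  , i) _ with () ← Inverse.to i a
      go (suc n , i) _ = begin
        sum g                                             ≡⟨ sum-remove {i = k} g ⟩
        g k xor sum (λ l → g (punchIn k l))               ≡⟨ cong₂ _xor_ (cong f (Inverse.strictlyInverseʳ i a))
                                                                (trans (sum-cong-≗ others) (sum-replicate-zero n)) ⟩
        f a xor false                                     ≡⟨ CommutativeRing.+-identityʳ xor-∧-commutativeRing (f a) ⟩
        f a                                               ∎
        where
        open ≡-Reasoning
        g : Fin (suc n) → Bool
        g = f ∘ Inverse.from i
        k : Fin (suc n)
        k = Inverse.to i a
        others : ∀ l → g (punchIn k l) ≡ false
        others l = vanish _ λ eq → punchInᵢ≢i k l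
          (trans (sym (Inverse.strictlyInverseˡ i _)) (cong (Inverse.to i) eq))

  ∑-select : ∀ (f : A → Bool) a → ∑ F (λ b → f b ∧ does (finite⇒≟ F a b)) ≡ f a
  ∑-select f a = begin
    ∑ F (λ b → f b ∧ does (finite⇒≟ F a b)) ≡⟨ ∑-only (λ b → f b ∧ does (finite⇒≟ F a b)) a vanish ⟩
    f a ∧ does (finite⇒≟ F a a)             ≡⟨ cong (f a ∧_) (dec-true (finite⇒≟ F a a) refl) ⟩
    f a ∧ true                              ≡⟨ ∧-identityʳ (f a) ⟩
    f a                                     ∎
    where
    open ≡-Reasoning
    vanish : ∀ b → b ≢ a → f b ∧ does (finite⇒≟ F a b) ≡ false
    vanish b b≢a = trans (cong (f b ∧_) (dec-false (finite⇒≟ F a b) (b≢a ∘ sym))) (∧-zeroʳ (f b))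

opaque
  unfolding ∑

  ∑-swap : ∀ {A B} (F : Finite A) (G : Finite B) (f : A → B → Bool) →
           ∑ F (λ a → ∑ G (f a)) ≡ ∑ G (λ b → ∑ F (λ a → f a b))
  ∑-swap (_ , i) (_ , j) f = ∑-comm (λ k l → f (Inverse.from i k) (Inverse.from j l))

-- Parity in cubic graphs

module _ (G : Graph) where

  infix 4 _≟ᵛ_ _≟ᵉ_

  _≟ᵛ_ : DecidableEquality (Vertex G)
  _≟ᵛ_ = finite⇒≟ (finiteVertex G)

  _≟ᵉ_ : DecidableEquality (Edge G)
  _≟ᵉ_ = finite⇒≟ (finiteEdge G)

  -- Looplessness rules out the mixed cases, so the pairs counted by `HasDegree` are just the edges
  -- at `v`.
  incident-irrelevant : ∀ {v e} (p q : Incident G v e) → p ≡ q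
  incident-irrelevant (inj₁ refl) (inj₁ refl) = refl
  incident-irrelevant (inj₂ refl) (inj₂ refl) = refl
  incident-irrelevant {e = e} (inj₁ p) (inj₂ q) = contradiction (trans (sym p) q) (loopless G e)
  incident-irrelevant {e = e} (inj₂ p) (inj₁ q) = contradiction (trans (sym q) p) (loopless G e)

  incident-pair : ∀ {v e f} → e ≡ f → (p : Incident G v e) (q : Incident G v f) →
                  _≡_ {A = Σ[ e ∈ Edge G ] Incident G v e} (e , p) (f , q)
  incident-pair refl p q = cong (_ ,_) (incident-irrelevant p q)

  -- Without loops at most one disjunct holds, so `xor` agrees with "or"; unlike "or", it lets sums
  -- split over the two ends of an edge.
  incidence : Vertex G → Edge G → Bool
  incidence v e = does (proj₁ (ends G e) ≟ᵛ v) xor does (proj₂ (ends G e) ≟ᵛ v)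

  incidence-true : ∀ {v e} → Incident G v e → incidence v e ≡ true
  incidence-true {v} {e} (inj₁ refl)
    rewrite dec-true (v ≟ᵛ v) refl
          | dec-false (proj₂ (ends G e) ≟ᵛ v) (loopless G e ∘ sym) = refl
  incidence-true {v} {e} (inj₂ refl)
    rewrite dec-true (v ≟ᵛ v) refl
          | dec-false (proj₁ (ends G e) ≟ᵛ v) (loopless G e) = refl

  incidence-false : ∀ {v e} → ¬ Incident G v e → incidence v e ≡ false
  incidence-false {v} {e} ¬inc
    rewrite dec-false (proj₁ (ends G e) ≟ᵛ v) (¬inc ∘ inj₁ ∘ sym)
          | dec-false (proj₂ (ends G e) ≟ᵛ v) (¬inc ∘ inj₂ ∘ sym) = refl

  opaque

    parity : (Edge G → Bool) → Vertex G → Bool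
    parity f v = ∑ (finiteEdge G) (λ e → f e ∧ incidence v e)

  Odd : (Edge G → Bool) → Set
  Odd f = ∀ v → parity f v ≡ true

  opaque
    unfolding parity

    -- Handshake lemma modulo 2: after exchanging the sums, every edge contributes once for each of
    -- its two ends.
    ∑-parity : ∀ f → ∑ (finiteVertex G) (parity f) ≡ false
    ∑-parity f = begin
      ∑ V (λ v → ∑ E (λ e → f e ∧ incidence v e)) ≡⟨ ∑-swap V E (λ v e → f e ∧ incidence v e) ⟩
      ∑ E (λ e → ∑ V (λ v → f e ∧ incidence v e)) ≡⟨ ∑-cong E twice ⟩
      ∑ E (λ _ → false)                           ≡⟨ ∑-false E ⟩
      false                                       ∎
      where
      open ≡-Reasoning
      V : Finite (Vertex G)
      V = finiteVertex G
      E : Finite (Edge G)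
      E = finiteEdge G
      twice : ∀ e → ∑ V (λ v → f e ∧ incidence v e) ≡ false
      twice e = begin
        ∑ V (λ v → f e ∧ incidence v e)
          ≡⟨ ∑-cong V (λ v → ∧-distribˡ-xor (f e) (does (proj₁ (ends G e) ≟ᵛ v)) (does (proj₂ (ends G e) ≟ᵛ v))) ⟩
        ∑ V (λ v → (f e ∧ does (proj₁ (ends G e) ≟ᵛ v)) xor (f e ∧ does (proj₂ (ends G e) ≟ᵛ v)))
          ≡⟨ ∑-xor V (λ v → f e ∧ does (proj₁ (ends G e) ≟ᵛ v)) (λ v → f e ∧ does (proj₂ (ends G e) ≟ᵛ v)) ⟩
        ∑ V (λ v → f e ∧ does (proj₁ (ends G e) ≟ᵛ v)) xor ∑ V (λ v → f e ∧ does (proj₂ (ends G e) ≟ᵛ v))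
          ≡⟨ cong₂ _xor_ (∑-select V (λ _ → f e) (proj₁ (ends G e))) (∑-select V (λ _ → f e) (proj₂ (ends G e))) ⟩
        f e xor f e
          ≡⟨ xor-same (f e) ⟩
        false ∎

    parity-unique : ∀ f v e → Incident G v e → f e ≡ true →
                    (∀ e′ → Incident G v e′ → f e′ ≡ true → e′ ≡ e) → parity f v ≡ true
    parity-unique f v e inc fe unique = begin
      parity f v          ≡⟨ ∑-only (finiteEdge G) (λ e → f e ∧ incidence v e) e vanish ⟩
      f e ∧ incidence v e ≡⟨ cong₂ _∧_ fe (incidence-true inc) ⟩
      true                ∎
      where
      open ≡-Reasoning
      vanish : ∀ e′ → e′ ≢ e → f e′ ∧ incidence v e′ ≡ false
      vanish e′ e′≢e with f e′ in fe′
      ... | false = refl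
      ... | true  = incidence-false (λ inc′ → e′≢e (unique e′ inc′ fe′))

  -- In a cubic graph these are all the edges at `v` (`claw-covers`), listed in a chosen order.
  record Claw (v : Vertex G) (e f g : Edge G) : Set where
    field
      incident₁ : Incident G v e
      incident₂ : Incident G v f
      incident₃ : Incident G v g
      distinct₁₂ : e ≢ f
      distinct₁₃ : e ≢ g
      distinct₂₃ : f ≢ g

  open Claw

  rotate : ∀ {v e f g} → Claw v e f g → Claw v f g e
  rotate c = record
    { incident₁ = incident₂ c ; incident₂ = incident₃ c ; incident₃ = incident₁ c
    ; distinct₁₂ = distinct₂₃ c ; distinct₁₃ = distinct₁₂ c ∘ sym ; distinct₂₃ = distinct₁₃ c ∘ sym }

  module _ {v : Vertex G} {d : ℕ} (degree : HasDegree G v d) where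

    slot : ∀ {e} → Incident G v e → Fin d
    slot p = Inverse.to degree (_ , p)

    edgeAt : Fin d → Edge G
    edgeAt i = proj₁ (Inverse.from degree i)

    edgeAt-incident : ∀ i → Incident G v (edgeAt i)
    edgeAt-incident i = proj₂ (Inverse.from degree i)

    edgeAt-slot : ∀ {e} (p : Incident G v e) → edgeAt (slot p) ≡ e
    edgeAt-slot p = cong proj₁ (Inverse.strictlyInverseʳ degree (_ , p))

    slot-injective : ∀ {e f} (p : Incident G v e) (q : Incident G v f) → slot p ≡ slot q → e ≡ f
    slot-injective p q eq = trans (sym (edgeAt-slot p)) (trans (cong edgeAt eq) (edgeAt-slot q))

    edgeAt-injective : ∀ {i j} → edgeAt i ≡ edgeAt j → i ≡ j
    edgeAt-injective {i} {j} eq = begin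
      i                        ≡⟨ Inverse.strictlyInverseˡ degree i ⟨
      slot (edgeAt-incident i) ≡⟨ cong (Inverse.to degree) (incident-pair eq _ _) ⟩
      slot (edgeAt-incident j) ≡⟨ Inverse.strictlyInverseˡ degree j ⟩
      j                        ∎
      where open ≡-Reasoning

    proper⇒injective : ∀ {k} {c : Edge G → Fin k} → Proper G c → Injective _≡_ _≡_ (c ∘ edgeAt)
    proper⇒injective proper {i} {j} eq =
      edgeAt-injective (proper v _ _ (edgeAt-incident i) (edgeAt-incident j) eq)

  module _ (cubic : Cubic G) where

    private
      third : (i j : Fin 3) → i ≢ j → ∃ λ k → i ≢ k × j ≢ k
      third zero             zero             i≢j = contradiction refl i≢j
      third zero             (suc zero)       _   = suc (suc zero) , (λ ()) , (λ ())
      third zero             (suc (suc zero)) _   = suc zero , (λ ()) , (λ ())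
      third (suc zero)       zero             _   = suc (suc zero) , (λ ()) , (λ ())
      third (suc zero)       (suc zero)       i≢j = contradiction refl i≢j
      third (suc zero)       (suc (suc zero)) _   = zero , (λ ()) , (λ ())
      third (suc (suc zero)) zero             _   = suc zero , (λ ()) , (λ ())
      third (suc (suc zero)) (suc zero)       _   = zero , (λ ()) , (λ ())
      third (suc (suc zero)) (suc (suc zero)) i≢j = contradiction refl i≢j

      only-three : (i j k l : Fin 3) → i ≢ j → i ≢ k → j ≢ k → l ≢ i → l ≢ j → l ≢ k → ⊥
      only-three i j k l i≢j i≢k j≢k l≢i l≢j l≢k =
        contradiction (injective⇒≤ {f = four} four-injective) 1+n≰n
        where
        four : Fin 4 → Fin 3
        four zero = i
        four (suc zero) = j
        four (suc (suc zero)) = k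
        four (suc (suc (suc zero))) = l
        four-injective : Injective _≡_ _≡_ four
        four-injective {zero} {zero} _ = refl
        four-injective {zero} {suc zero} eq = contradiction eq i≢j
        four-injective {zero} {suc (suc zero)} eq = contradiction eq i≢k
        four-injective {zero} {suc (suc (suc zero))} eq = contradiction (sym eq) l≢i
        four-injective {suc zero} {zero} eq = contradiction (sym eq) i≢j
        four-injective {suc zero} {suc zero} _ = refl
        four-injective {suc zero} {suc (suc zero)} eq = contradiction eq j≢k
        four-injective {suc zero} {suc (suc (suc zero))} eq = contradiction (sym eq) l≢j
        four-injective {suc (suc zero)} {zero} eq = contradiction (sym eq) i≢k
        four-injective {suc (suc zero)} {suc zero} eq = contradiction (sym eq) j≢k
        four-injective {suc (suc zero)} {suc (suc zero)} _ = refl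
        four-injective {suc (suc zero)} {suc (suc (suc zero))} eq = contradiction (sym eq) l≢k
        four-injective {suc (suc (suc zero))} {zero} eq = contradiction eq l≢i
        four-injective {suc (suc (suc zero))} {suc zero} eq = contradiction eq l≢j
        four-injective {suc (suc (suc zero))} {suc (suc zero)} eq = contradiction eq l≢k
        four-injective {suc (suc (suc zero))} {suc (suc (suc zero))} _ = refl

    complete-claw : ∀ {v e f} → Incident G v e → Incident G v f → e ≢ f → ∃ (Claw v e f)
    complete-claw {v} p q e≢f
      with k , i≢k , j≢k ← third (slot (cubic v) p) (slot (cubic v) q) (e≢f ∘ slot-injective (cubic v) p q) =
      edgeAt (cubic v) k , record
      { incident₁ = p ; incident₂ = q ; incident₃ = edgeAt-incident (cubic v) k
      ; distinct₁₂ = e≢f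
      ; distinct₁₃ = λ eq → i≢k (edgeAt-injective (cubic v) (trans (edgeAt-slot (cubic v) p) eq))
      ; distinct₂₃ = λ eq → j≢k (edgeAt-injective (cubic v) (trans (edgeAt-slot (cubic v) q) eq)) }

    claw-from : ∀ {v e} → Incident G v e → ∃ λ f → ∃ λ g → Claw v e f g
    claw-from {v} p = _ , complete-claw p (edgeAt-incident (cubic v) k)
      (λ eq → proj₂ other (edgeAt-injective (cubic v) (trans (edgeAt-slot (cubic v) p) eq)))
      where
      another : (i : Fin 3) → ∃ λ j → i ≢ j
      another zero    = suc zero , λ ()
      another (suc _) = zero , λ ()
      other = another (slot (cubic v) p)
      k = proj₁ other

    claw-at : ∀ v → ∃ λ e → ∃ λ f → ∃ λ g → Claw v e f g
    claw-at v = _ , claw-from (edgeAt-incident (cubic v) zero)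

    claw-covers : ∀ {v e f g x} → Claw v e f g → Incident G v x → x ≡ e ⊎ x ≡ f ⊎ x ≡ g
    claw-covers {v} {e} {f} {g} {x} c p with x ≟ᵉ e | x ≟ᵉ f | x ≟ᵉ g
    ... | yes x≡e | _       | _       = inj₁ x≡e
    ... | no  _   | yes x≡f | _       = inj₂ (inj₁ x≡f)
    ... | no  _   | no  _   | yes x≡g = inj₂ (inj₂ x≡g)
    ... | no  x≢e | no  x≢f | no  x≢g = ⊥-elim
      (only-three (slot (cubic v) (incident₁ c)) (slot (cubic v) (incident₂ c)) (slot (cubic v) (incident₃ c)) (slot (cubic v) p)
        (distinct₁₂ c ∘ slot-injective (cubic v) _ _) (distinct₁₃ c ∘ slot-injective (cubic v) _ _) (distinct₂₃ c ∘ slot-injective (cubic v) _ _)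
        (x≢e ∘ slot-injective (cubic v) _ _) (x≢f ∘ slot-injective (cubic v) _ _) (x≢g ∘ slot-injective (cubic v) _ _))

    opaque
      unfolding parity

      -- A claw exhausts the edges at `v`, so incidence with `v` is the sum of the three indicator
      -- functions of its edges.
      parity-claw : ∀ φ {v e f g} → Claw v e f g → parity φ v ≡ φ e xor (φ f xor φ g)
      parity-claw φ {v} {e} {f} {g} c = begin
        parity φ v
          ≡⟨ ∑-cong E pointwise ⟩
        ∑ E (λ x → φ∧δ e x xor (φ∧δ f x xor φ∧δ g x))
          ≡⟨ trans (∑-xor E (φ∧δ e) (λ x → φ∧δ f x xor φ∧δ g x)) (cong (∑ E (φ∧δ e) xor_) (∑-xor E (φ∧δ f) (φ∧δ g))) ⟩
        ∑ E (φ∧δ e) xor (∑ E (φ∧δ f) xor ∑ E (φ∧δ g))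
          ≡⟨ cong₂ _xor_ (∑-select E φ e) (cong₂ _xor_ (∑-select E φ f) (∑-select E φ g)) ⟩
        φ e xor (φ f xor φ g) ∎
        where
        open ≡-Reasoning
        E : Finite (Edge G)
        E = finiteEdge G
        δ : Edge G → Edge G → Bool
        δ x y = does (x ≟ᵉ y)
        φ∧δ : Edge G → Edge G → Bool
        φ∧δ x y = φ y ∧ δ x y
        δ-refl : ∀ x → δ x x ≡ true
        δ-refl x = dec-true (x ≟ᵉ x) refl
        δ-≢ : ∀ {x y} → x ≢ y → δ x y ≡ false
        δ-≢ {x} {y} = dec-false (x ≟ᵉ y)
        incidence-δ : ∀ x → incidence v x ≡ δ e x xor (δ f x xor δ g x)
        incidence-δ x with x ≟ᵉ e
        ... | yes refl rewrite δ-refl e | δ-≢ (distinct₁₂ c ∘ sym) | δ-≢ (distinct₁₃ c ∘ sym) = incidence-true (incident₁ c)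
        ... | no x≢e with x ≟ᵉ f
        ...   | yes refl rewrite δ-refl f | δ-≢ (distinct₁₂ c) | δ-≢ (distinct₂₃ c ∘ sym) = incidence-true (incident₂ c)
        ...   | no x≢f with x ≟ᵉ g
        ...     | yes refl rewrite δ-refl g | δ-≢ (distinct₁₃ c) | δ-≢ (distinct₂₃ c) = incidence-true (incident₃ c)
        ...     | no x≢g rewrite δ-≢ (x≢e ∘ sym) | δ-≢ (x≢f ∘ sym) | δ-≢ (x≢g ∘ sym) =
          incidence-false (λ p → [ x≢e , [ x≢f , x≢g ]′ ]′ (claw-covers c p))
        pointwise : ∀ x → φ x ∧ incidence v x ≡ φ∧δ e x xor (φ∧δ f x xor φ∧δ g x)
        pointwise x = begin
          φ x ∧ incidence v x                                       ≡⟨ cong (φ x ∧_) (incidence-δ x) ⟩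
          φ x ∧ (δ e x xor (δ f x xor δ g x))                       ≡⟨ ∧-distribˡ-xor (φ x) _ _ ⟩
          φ∧δ e x xor (φ x ∧ (δ f x xor δ g x))               ≡⟨ cong (φ∧δ e x xor_) (∧-distribˡ-xor (φ x) _ _) ⟩
          φ∧δ e x xor (φ∧δ f x xor φ∧δ g x)       ∎

    parity-not : ∀ φ v → parity (not ∘ φ) v ≡ not (parity φ v)
    parity-not φ v with _ , _ , _ , c ← claw-at v
      rewrite parity-claw φ c | parity-claw (not ∘ φ) c = three (φ _) (φ _) (φ _)
      where
      three : ∀ a b c → not a xor (not b xor not c) ≡ not (a xor (b xor c))
      three false false false = refl
      three false false true  = refl
      three false true  false = refl
      three false true  true  = refl
      three true  false false = refl
      three true  false true  = refl
      three true  true  false = refl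
      three true  true  true  = refl

    -- Complementing turns oddness into evenness, and the parities sum to 0
    -- over all vertices.
    odd-off⇒odd : ∀ φ v₀ → (∀ v → v ≢ v₀ → parity φ v ≡ true) → Odd φ
    odd-off⇒odd φ v₀ odd-off v with v ≟ᵛ v₀
    ... | no v≢v₀  = odd-off v v≢v₀
    ... | yes refl = not-false (begin
      not (parity φ v)                       ≡⟨ parity-not φ v ⟨
      parity (not ∘ φ) v                     ≡⟨ ∑-only (finiteVertex G) (parity (not ∘ φ)) v even-off ⟨
      ∑ (finiteVertex G) (parity (not ∘ φ))  ≡⟨ ∑-parity (not ∘ φ) ⟩
      false                                  ∎)
      where
      open ≡-Reasoning
      even-off : ∀ w → w ≢ v → parity (not ∘ φ) w ≡ false
      even-off w w≢v = trans (parity-not φ w) (cong not (odd-off w w≢v))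
      not-false : ∀ {b} → not b ≡ false → b ≡ true
      not-false {true} _ = refl

open Claw

-- Colourings of G + tM

T⇒≡ : ∀ {b} → T b → b ≡ true
T⇒≡ = Equivalence.to T-≡

≡⇒T : ∀ {b} → b ≡ true → T b
≡⇒T = Equivalence.from T-≡

does-true : ∀ {P : Set} (P? : Dec P) → does P? ≡ true → P
does-true (yes p) _ = p

δ : ∀ {k} → Fin k → Fin k → Bool
δ i a = does (i ≟ᶠ a)

δ-refl : ∀ {k} (i : Fin k) → δ i i ≡ true
δ-refl i = dec-true (i ≟ᶠ i) refl

δ-≢ : ∀ {k} {i a : Fin k} → i ≢ a → δ i a ≡ false
δ-≢ {i = i} {a} = dec-false (i ≟ᶠ a)

-- The colours occurring on an edge and its parallel copies: one colour if the
-- edge is not in the matching, and all but two otherwise.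
Shape : ∀ {k} → Bool → (Fin k → Bool) → Set
Shape false φ = ∃ λ i → ∀ a → φ a ≡ δ i a
Shape true  φ = ∃ λ i → ∃ λ j → i ≢ j × (∀ a → φ a ≡ not (δ i a xor δ j a))

xor-solve : ∀ x y z → x xor (y xor z) ≡ true → x ≡ not (y xor z)
xor-solve true  false false _ = refl
xor-solve true  true  true  _ = refl
xor-solve false false true  _ = refl
xor-solve false true  false _ = refl

-- Enumerates the `suc t` colours other than `i` and `j`: `punchOut i≢j` is the position of `j` once
-- `i` has been removed.
complement : ∀ {t} {i j : Fin (3 + t)} → i ≢ j → Fin (suc t) → Fin (3 + t)
complement {i = i} i≢j l = punchIn i (punchIn (punchOut i≢j) l)

complement-injective : ∀ {t} {i j : Fin (3 + t)} (i≢j : i ≢ j) {l m} →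
                       complement i≢j l ≡ complement i≢j m → l ≡ m
complement-injective {i = i} i≢j eq =
  punchIn-injective (punchOut i≢j) _ _ (punchIn-injective i _ _ eq)

complement-avoids : ∀ {t} {i j : Fin (3 + t)} (i≢j : i ≢ j) l →
                    not (δ i (complement i≢j l) xor δ j (complement i≢j l)) ≡ true
complement-avoids {i = i} {j} i≢j l
  rewrite δ-≢ {i = i} (punchInᵢ≢i i (punchIn (punchOut i≢j) l) ∘ sym)
        | δ-≢ {i = j} (λ eq → punchInᵢ≢i (punchOut i≢j) l
            (punchIn-injective i _ _ (trans (sym eq) (sym (punchIn-punchOut i≢j))))) = refl

Parallel : ℕ → Bool → Set
Parallel t b = ⊤ ⊎ (T b × Fin t)

colour : ∀ {t} b {φ : Fin (3 + t) → Bool} → Shape b φ → Parallel t b → Fin (3 + t)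
colour false (i , _)           _              = i
colour true  (_ , _ , i≢j , _) (inj₁ _)       = complement i≢j zero
colour true  (_ , _ , i≢j , _) (inj₂ (_ , l)) = complement i≢j (suc l)

colour-occurs : ∀ {t} b {φ : Fin (3 + t) → Bool} (s : Shape b φ) p → φ (colour b s p) ≡ true
colour-occurs false (i , φ≗)           p              = trans (φ≗ i) (δ-refl i)
colour-occurs true  (_ , _ , i≢j , φ≗) (inj₁ _)       = trans (φ≗ _) (complement-avoids i≢j zero)
colour-occurs true  (_ , _ , i≢j , φ≗) (inj₂ (_ , l)) = trans (φ≗ _) (complement-avoids i≢j (suc l))

colour-injective : ∀ {t} b {φ : Fin (3 + t) → Bool} (s : Shape b φ) p q →
                   colour b s p ≡ colour b s q → p ≡ q
colour-injective false _ (inj₁ _) (inj₁ _) _ = refl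
colour-injective true  _ (inj₁ _) (inj₁ _) _ = refl
colour-injective true  (_ , _ , i≢j , _) (inj₁ _) (inj₂ _) eq with () ← complement-injective i≢j eq
colour-injective true  (_ , _ , i≢j , _) (inj₂ _) (inj₁ _) eq with () ← complement-injective i≢j eq
colour-injective true  (_ , _ , i≢j , _) (inj₂ (_ , _)) (inj₂ (_ , _)) eq
  with refl ← complement-injective i≢j eq = refl

module _ (G : Graph) (M : EdgeSet G) (t : ℕ) where

  -- Properness is replaced by oddness, a condition linear modulo 2 that passes easily between
  -- graphs; together with the shapes and a perfect matching it gives properness back
  -- (`colours-disjoint`).
  record ColourSets : Set where
    field
      colours : Edge G → Fin (3 + t) → Bool
      odd     : ∀ a → Odd G (λ e → colours e a)
      shape   : ∀ e → Shape (M e) (colours e)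

  base : Edge (G ⊕ t · M) → Edge G
  base (inj₁ e)             = e
  base (inj₂ ((e , _) , _)) = e

  base-incident : ∀ {v} e → Incident (G ⊕ t · M) v e → Incident G v (base e)
  base-incident (inj₁ _) p = p
  base-incident (inj₂ _) p = p

  incident-over : ∀ {v} e → Incident G v (base e) → Incident (G ⊕ t · M) v e
  incident-over (inj₁ _) p = p
  incident-over (inj₂ _) p = p

  copy : ∀ e → Parallel t (M e)
       → Edge (G ⊕ t · M)
  copy e (inj₁ _)       = inj₁ e
  copy e (inj₂ (p , l)) = inj₂ ((e , p) , l)

  copyOf : ∀ e → Parallel t (M (base e))
  copyOf (inj₁ _)             = inj₁ tt
  copyOf (inj₂ ((_ , p) , l)) = inj₂ (p , l)

module _ (G : Graph) (cubic : Cubic G) (M : EdgeSet G) where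

  private
    sole : ∀ {v e f g} → Claw G v e f g → M e ≡ true → M f ≡ false → M g ≡ false →
           ∃! _≡_ λ e → T (M e) × Incident G v e
    sole {e = e} {f} {g} c Me Mf Mg = e , (≡⇒T Me , incident₁ c) , λ (Mx , p) → only (claw-covers G cubic c p) Mx
      where
      only : ∀ {x} → x ≡ e ⊎ x ≡ f ⊎ x ≡ g → T (M x) → e ≡ x
      only (inj₁ refl)        _  = refl
      only (inj₂ (inj₁ refl)) Mx = contradiction (trans (sym Mf) (T⇒≡ Mx)) λ ()
      only (inj₂ (inj₂ refl)) Mx = contradiction (trans (sym Mg) (T⇒≡ Mx)) λ ()

  -- An odd number of the three edges is in `M`, and not all three because `e` and `f` are not both
  -- in it; hence exactly one is.
  claw-matched : ∀ {v e f g} → Claw G v e f g → M e xor (M f xor M g) ≡ true → M e ∧ M f ≡ false →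
                 ∃! _≡_ λ e → T (M e) × Incident G v e
  claw-matched {v} {e} {f} {g} c one not-both with M e in Me | M f in Mf | M g in Mg
  claw-matched c _  _  | true  | false | false = sole c Me Mf Mg
  claw-matched c _  _  | false | true  | false = sole (rotate G c) Mf Mg Me
  claw-matched c _  _  | false | false | true  = sole (rotate G (rotate G c)) Mg Me Mf
  claw-matched c _  () | true  | true  | _
  claw-matched c () _  | true  | false | true
  claw-matched c () _  | false | true  | true
  claw-matched c () _  | false | false | false

module _ (G : Graph) (cubic : Cubic G) (M : EdgeSet G) (matching : PerfectMatching G M) (t : ℕ) where

  open ColourSets

  matched-unique : ∀ {v e f} → Incident G v e → Incident G v f → M e ≡ true → M f ≡ true → e ≡ f
  matched-unique {v} p q Me Mf with _ , _ , unique ← matching v =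
    trans (sym (unique (≡⇒T Me , p))) (unique (≡⇒T Mf , q))

  unmatched : ∀ {v e f} → Incident G v e → Incident G v f → e ≢ f → M e ≡ true → M f ≡ false
  unmatched {f = f} p q e≢f Me with M f in Mf
  ... | false = refl
  ... | true  = contradiction (matched-unique p q Me Mf) e≢f

  matching-odd : Odd G M
  matching-odd v with e , (Me , p) , unique ← matching v =
    parity-unique G M v e p (T⇒≡ Me) (λ e′ q Me′ → sym (unique (≡⇒T Me′ , q)))

  -- All extra copies at `v` lie over the one matching edge there, which adds `t` to the degree 3.
  degree-⊕ : ∀ v → HasDegree (G ⊕ t · M) v (3 + t)
  degree-⊕ v = ↔-trans split (↔-trans (cubic v ⊎-cong ↔-refl) (↔-sym (+↔⊎ {3} {t})))
    where
    Copies : Set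
    Copies = Σ[ e ∈ Edge (G ⊕ t · M) ] Incident (G ⊕ t · M) v e
    m = proj₁ (matching v)
    Mm = proj₁ (proj₁ (proj₂ (matching v)))
    v∈m = proj₂ (proj₁ (proj₂ (matching v)))
    to : Copies → (Σ[ e ∈ Edge G ] Incident G v e) ⊎ Fin t
    to (inj₁ e , p)       = inj₁ (e , p)
    to (inj₂ (_ , l) , _) = inj₂ l
    from : (Σ[ e ∈ Edge G ] Incident G v e) ⊎ Fin t → Copies
    from (inj₁ (e , p)) = inj₁ e , p
    from (inj₂ l)       = inj₂ ((m , Mm) , l) , v∈m
    from-to : ∀ x → from (to x) ≡ x
    from-to (inj₁ e , p) = refl
    from-to (inj₂ ((e , Me) , l) , p) with refl ← proj₂ (proj₂ (matching v)) (Me , p)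
      with refl ← T-irrelevant Mm Me | refl ← incident-irrelevant G v∈m p = refl
    split : Copies ↔ ((Σ[ e ∈ Edge G ] Incident G v e) ⊎ Fin t)
    split = mk↔ₛ′ to from (λ { (inj₁ _) → refl ; (inj₂ _) → refl }) from-to

  -- By regularity the maximum degree can only be `3 + t`.
  classI⇒colourable : ClassI (G ⊕ t · M) → EdgeColourable (G ⊕ t · M) (3 + t)
  classI⇒colourable (k , ((v , degree) , _) , (colourable , _)) =
    subst (EdgeColourable (G ⊕ t · M)) (↔⇒≡ (↔-trans (↔-sym degree) (degree-⊕ v))) colourable

  -- Fewer colours are impossible because the `3 + t` edges at `v₀` need different ones; `v₀` also
  -- witnesses that the maximum degree is attained.
  colourable⇒classI : Vertex G → EdgeColourable (G ⊕ t · M) (3 + t) → ClassI (G ⊕ t · M)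
  colourable⇒classI v₀ colourable = 3 + t
    , ((v₀ , degree-⊕ v₀) , λ v d degree → ≤-reflexive (↔⇒≡ (↔-trans (↔-sym degree) (degree-⊕ v))))
    , colourable
    , λ j (c , proper) → injective⇒≤ (proper⇒injective (G ⊕ t · M) (degree-⊕ v₀) proper)

  colourable⇒colourSets : EdgeColourable (G ⊕ t · M) (3 + t) → ColourSets G M t
  colourable⇒colourSets (c , proper) = record { colours = χ ; odd = χ-odd ; shape = χ-shape }
    where
    Gₜ = G ⊕ t · M
    Occurs : Edge G → Fin (3 + t) → Set
    Occurs e a = ∃ λ e′ → base G M t e′ ≡ e × c e′ ≡ a
    occurs? : ∀ e a → Dec (Occurs e a)
    occurs? e a = finite-any? (finiteEdge Gₜ) (λ e′ → finite⇒≟ (finiteEdge G) (base G M t e′) e ×-dec (c e′ ≟ᶠ a))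
    χ : Edge G → Fin (3 + t) → Bool
    χ e a = does (occurs? e a)
    -- There are as many edges at `v` as colours, and their colours differ, so each colour occurs at
    -- `v`.
    hit : ∀ v a → ∃ λ e → Incident Gₜ v e × c e ≡ a
    hit v a with i , eq ← injective⇒hits (proper⇒injective Gₜ (degree-⊕ v) proper) a =
      edgeAt Gₜ (degree-⊕ v) i , edgeAt-incident Gₜ (degree-⊕ v) i , eq
    χ-odd : ∀ a → Odd G (λ e → χ e a)
    χ-odd a v with e , p , ce≡a ← hit v a =
      parity-unique G (λ e → χ e a) v (base G M t e) (base-incident G M t e p)
        (dec-true (occurs? _ a) (e , refl , ce≡a)) unique
      where
      unique : ∀ f → Incident G v f → χ f a ≡ true → f ≡ base G M t e
      unique f q χfa with f′ , refl , cf′≡a ← does-true (occurs? f a) χfa =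
        cong (base G M t) (proper v f′ e (incident-over G M t f′ q) p (trans cf′≡a (sym ce≡a)))
    single : ∀ e → M e ≡ false → ∀ a → χ e a ≡ δ (c (inj₁ e)) a
    single e Me a with c (inj₁ e) ≟ᶠ a
    ... | yes ce≡a = dec-true (occurs? e a) (inj₁ e , refl , ce≡a)
    ... | no  ce≢a = dec-false (occurs? e a) λ where
      (inj₁ _ , refl , eq) → ce≢a eq
      (inj₂ ((_ , T-Me) , _) , refl , _) → contradiction (trans (sym Me) (T⇒≡ T-Me)) λ ()
    χ-shape : ∀ e → Shape (M e) (χ e)
    χ-shape e with M e in Me
    ... | false = c (inj₁ e) , single e Me
    -- The other two edges at an end of `e` are off `M` and have one colour each; oddness leaves
    -- exactly the remaining colours to `e`.
    ... | true with f , g , claw ← claw-from G cubic {proj₁ (ends G e)} {e} (inj₁ refl) =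
      c (inj₁ f) , c (inj₁ g)
        , (λ eq → distinct₂₃ claw (cong (base G M t)
            (proper (proj₁ (ends G e)) (inj₁ f) (inj₁ g) (incident₂ claw) (incident₃ claw) eq)))
        , λ a → trans (xor-solve (χ e a) (χ f a) (χ g a) (trans (sym (parity-claw G cubic (λ x → χ x a) claw)) (χ-odd a _)))
            (cong not (cong₂ _xor_
              (single f (unmatched (incident₁ claw) (incident₂ claw) (distinct₁₂ claw) Me) a)
              (single g (unmatched (incident₁ claw) (incident₃ claw) (distinct₁₃ claw) Me) a)))

  module _ (C : ColourSets G M t) where

    private
      χ = colours C

      single : ∀ {e} → M e ≡ false → ∀ {a} → χ e a ≡ true → ∀ b → χ e b ≡ δ a b
      single {e} Me {a} χea b with M e | shape C e
      ... | false | i , χe≗ with refl ← does-true (i ≟ᶠ a) (trans (sym (χe≗ a)) χea) = χe≗ b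

      not-all : ∀ {e} → M e ≡ true → ¬ (∀ a → χ e a ≡ true)
      not-all {e} Me all with M e | shape C e
      ... | true | i , j , i≢j , χe≗ with trans (sym (χe≗ i)) (all i)
      ... | eq rewrite δ-refl i | δ-≢ (i≢j ∘ sym) with () ← eq

      -- Two edges of the single colour a cancel modulo 2, which would leave
      -- every colour to e.
      not-three : ∀ {v e f g a} → Claw G v e f g → M e ≡ true →
                  ¬ (χ f a ≡ true × χ g a ≡ true)
      not-three {v} {e} {f} {g} {a} claw Me (χfa , χga) = not-all Me λ b → begin
        χ e b                         ≡⟨ double (χ e b) (δ a b) ⟨
        χ e b xor (δ a b xor δ a b)   ≡⟨ cong (χ e b xor_) (cong₂ _xor_
                                           (single (unmatched (incident₁ claw) (incident₂ claw) (distinct₁₂ claw) Me) χfa b)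
                                           (single (unmatched (incident₁ claw) (incident₃ claw) (distinct₁₃ claw) Me) χga b)) ⟨
        χ e b xor (χ f b xor χ g b)   ≡⟨ parity-claw G cubic (λ x → χ x b) claw ⟨
        parity G (λ x → χ x b) v      ≡⟨ odd C b v ⟩
        true                          ∎
        where
        open ≡-Reasoning
        double : ∀ x y → x xor (y xor y) ≡ x
        double false false = refl
        double false true  = refl
        double true  false = refl
        double true  true  = refl

    -- If `e` and `f` share the colour `a`, oddness gives `a` to the third edge as well. One of the
    -- three edges is in `M`, and `not-three` applies to the other two.
    colours-disjoint : ∀ {v e f a} → Incident G v e → Incident G v f → χ e a ≡ true → χ f a ≡ true → e ≡ f
    colours-disjoint {v} {e} {f} {a} p q χea χfa with finite⇒≟ (finiteEdge G) e f
    ... | yes e≡f = e≡f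
    ... | no  e≢f with g , claw ← complete-claw G cubic p q e≢f = ⊥-elim (by-matched-edge
      (trans (sym (parity-claw G cubic M claw)) (matching-odd v)))
      where
      χga : χ g a ≡ true
      χga with eq ← trans (sym (parity-claw G cubic (λ x → χ x a) claw)) (odd C a v)
        rewrite χea | χfa with χ g a
      ... | true  = refl
      ... | false with () ← eq
      by-matched-edge : M e xor (M f xor M g) ≡ true → ⊥
      by-matched-edge eq with M e in Me | M f in Mf | M g in Mg
      ... | true  | _     | _    = not-three claw Me (χfa , χga)
      ... | false | true  | _    = not-three (rotate G claw) Mf (χga , χea)
      ... | false | false | true = not-three (rotate G (rotate G claw)) Mg (χea , χfa)
      ... | false | false | false with () ← eq

    -- The colours of an edge are dealt out injectively to its copies; different edges that meet
    -- cannot clash because their colour sets are disjoint.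
    colourSets⇒colourable : EdgeColourable (G ⊕ t · M) (3 + t)
    colourSets⇒colourable = c , λ v e f p q eq → over e f
      (colours-disjoint (base-incident G M t e p) (base-incident G M t f q) (occurs e)
        (trans (cong (χ (base G M t f)) eq) (occurs f))) eq
      where
      c : Edge (G ⊕ t · M) → Fin (3 + t)
      c e = colour (M (base G M t e)) (shape C (base G M t e)) (copyOf G M t e)
      occurs : ∀ e → χ (base G M t e) (c e) ≡ true
      occurs e = colour-occurs (M (base G M t e)) (shape C (base G M t e)) (copyOf G M t e)
      over′ : ∀ e p q → colour (M e) (shape C e) p ≡ colour (M e) (shape C e) q → copy G M t e p ≡ copy G M t e q
      over′ e p q eq = cong (copy G M t e) (colour-injective (M e) (shape C e) p q eq)
      over : ∀ e f → base G M t e ≡ base G M t f → c e ≡ c f → e ≡ f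
      over (inj₁ e)       (inj₁ _)       refl eq = over′ e (inj₁ tt) (inj₁ tt) eq
      over (inj₁ e)       (inj₂ ((_ , p) , l)) refl eq = over′ e (inj₁ tt) (inj₂ (p , l)) eq
      over (inj₂ ((e , p) , l)) (inj₁ _)       refl eq = over′ e (inj₂ (p , l)) (inj₁ tt) eq
      over (inj₂ ((e , p) , l)) (inj₂ ((_ , q) , m)) refl eq = over′ e (inj₂ (p , l)) (inj₂ (q , m)) eq

-- Leaves of cubic Halin graphs

lastTip : ∀ b → Tip b
lastTip leaf       = tip
lastTip (fork _ b) = inʳ (lastTip b)

nextTip-lastTip : ∀ b → nextTip (lastTip b) ≡ nothing
nextTip-lastTip leaf       = refl
nextTip-lastTip (fork _ b) rewrite nextTip-lastTip b = refl

nextTip-inˡ : ∀ {a b} (x : Tip a) {y} → nextTip x ≡ just y → nextTip (inˡ {b = b} x) ≡ just (inˡ y)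
nextTip-inˡ x eq rewrite eq = refl

nextTip-inʳ : ∀ {a b} (x : Tip b) {y} → nextTip x ≡ just y → nextTip (inʳ {a = a} x) ≡ just (inʳ y)
nextTip-inʳ x eq rewrite eq = refl

nextTip-across : ∀ a b → nextTip (inˡ {b = b} (lastTip a)) ≡ just (inʳ (firstTip b))
nextTip-across a b rewrite nextTip-lastTip a = refl

nextTip-irreflexive : ∀ {b} (x : Tip b) → nextTip x ≢ just x
nextTip-irreflexive (inˡ x) eq with nextTip x in q
nextTip-irreflexive (inˡ x) refl | just _ = nextTip-irreflexive x q
nextTip-irreflexive (inʳ x) eq with nextTip x in q
nextTip-irreflexive (inʳ x) refl | just _ = nextTip-irreflexive x q

-- This and `reach-tip` are inductions along the leaves of one branch; at a fork both cross from the
-- last leaf of the left part to the first leaf of the right part.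
reach-lastTip : ∀ {b} (P : Tip b → Set) →
                (∀ x {y} → nextTip x ≡ just y → P x → P y) → ∀ x → P x → P (lastTip b)
reach-tip : ∀ {b} (P : Tip b → Set) →
            (∀ x {y} → nextTip x ≡ just y → P x → P y) → P (firstTip b) → ∀ x → P x

reach-lastTip P step tip p = p
reach-lastTip {fork a b} P step (inˡ x) p =
  reach-lastTip (P ∘ inʳ) (λ t → step (inʳ t) ∘ nextTip-inʳ t) (firstTip b)
    (step _ (nextTip-across a b) (reach-lastTip (P ∘ inˡ) (λ t → step (inˡ t) ∘ nextTip-inˡ t) x p))
reach-lastTip P step (inʳ x) p = reach-lastTip (P ∘ inʳ) (λ t → step (inʳ t) ∘ nextTip-inʳ t) x p

reach-tip P step p tip = p
reach-tip P step p (inˡ x) = reach-tip (P ∘ inˡ) (λ t → step (inˡ t) ∘ nextTip-inˡ t) p x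
reach-tip {fork a b} P step p (inʳ x) =
  reach-tip (P ∘ inʳ) (λ t → step (inʳ t) ∘ nextTip-inʳ t)
    (step _ (nextTip-across a b) (reach-lastTip (P ∘ inˡ) (λ t → step (inˡ t) ∘ nextTip-inˡ t) (firstTip a) p)) x

-- `Subtree B b`: a copy of b as the part of B that hangs from some edge.
record Subtree (B b : Branch) : Set where
  field
    node           : Node b → Node B
    tips           : Tip b → Tip B
    node-injective : ∀ {p q} → node p ≡ node q → p ≡ q
    parent-node    : ∀ {p q} → parent p ≡ just q → parent (node p) ≡ just (node q)
    tipNode-tips   : ∀ x → tipNode (tips x) ≡ node (tipNode x)
    nextTip-tips   : ∀ x {y} → nextTip x ≡ just y → nextTip (tips x) ≡ just (tips y)

open Subtree

whole : ∀ {B} → Subtree B B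
whole = record
  { node = id ; tips = id ; node-injective = id ; parent-node = id
  ; tipNode-tips = λ _ → refl ; nextTip-tips = λ _ → id }

module _ {B a b : Branch} (S : Subtree B (fork a b)) where

  leftPart : Subtree B a
  leftPart = record
    { node           = node S ∘ inˡ
    ; tips           = tips S ∘ inˡ
    ; node-injective = λ eq → case-inˡ (node-injective S eq)
    ; parent-node    = λ eq → parent-node S (cong (just ∘ maybe′ inˡ top) eq)
    ; tipNode-tips   = λ x → tipNode-tips S (inˡ x)
    ; nextTip-tips   = λ x → nextTip-tips S (inˡ x) ∘ nextTip-inˡ x
    }
    where
    case-inˡ : ∀ {p q : Node a} → Node.inˡ {a} {b} p ≡ inˡ q → p ≡ q
    case-inˡ refl = refl

  rightPart : Subtree B b
  rightPart = record
    { node           = node S ∘ inʳ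
    ; tips           = tips S ∘ inʳ
    ; node-injective = λ eq → case-inʳ (node-injective S eq)
    ; parent-node    = λ eq → parent-node S (cong (just ∘ maybe′ inʳ top) eq)
    ; tipNode-tips   = λ x → tipNode-tips S (inʳ x)
    ; nextTip-tips   = λ x → nextTip-tips S (inʳ x) ∘ nextTip-inʳ x
    }
    where
    case-inʳ : ∀ {p q : Node b} → Node.inʳ {a} {b} p ≡ inʳ q → p ≡ q
    case-inʳ refl = refl

module _ (H : CubicHalin) where

  successor-just : ∀ {i} x {y} → nextTip x ≡ just y → successor H (i , x) ≡ (i , y)
  successor-just x eq rewrite eq = refl

  successor-last : ∀ i → successor H (i , lastTip (branch H i)) ≡ (nextBranch H i , firstTip (branch H (nextBranch H i)))
  successor-last i rewrite nextTip-lastTip (branch H i) = refl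

  -- The wrap-around case lands in another branch. This keeps the twins on the left of a pole apart
  -- from those on its right.
  successor-irreflexive : ∀ x → successor H x ≢ x
  successor-irreflexive (i , x) eq with nextTip x in q
  successor-irreflexive (i , x) refl | just _ = nextTip-irreflexive x q
  successor-irreflexive (zero           , x) () | nothing
  successor-irreflexive (suc zero       , x) () | nothing
  successor-irreflexive (suc (suc zero) , x) () | nothing

  successor-across : ∀ {i a b} (S : Subtree (branch H i) (fork a b)) →
                     successor H (i , tips S (inˡ (lastTip a))) ≡ (i , tips S (inʳ (firstTip b)))
  successor-across {a = a} {b} S =
    successor-just (tips S (inˡ (lastTip a))) (nextTip-tips S (inˡ (lastTip a)) (nextTip-across a b))

  previousBranch : Fin 3 → Fin 3
  previousBranch zero             = suc (suc zero)
  previousBranch (suc zero)       = zero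
  previousBranch (suc (suc zero)) = suc zero

  lastLeaf : Fin 3 → Leaf H
  lastLeaf i = i , lastTip (branch H i)

  successor-previous : ∀ i → successor H (lastLeaf (previousBranch i)) ≡ (i , firstTip (branch H i))
  successor-previous zero             = successor-last (suc (suc zero))
  successor-previous (suc zero)       = successor-last zero
  successor-previous (suc (suc zero)) = successor-last (suc zero)

  -- The leaves form a single cycle under `successor`.
  leaf-induction : (P : Leaf H → Set) → (∀ x → P x → P (successor H x)) → ∀ {x} → P x → ∀ y → P y
  leaf-induction P step {i , x} p (j , y) =
    -- The route runs from `x` to the end of its branch, on to the first leaf of branch `zero`, then
    -- to the first leaf of branch `j`, and along that branch to `y`.
    reach-tip (λ t → P (j , t)) next (first j (first-zero i (to-next i x p))) y
    where
    next : ∀ {i} x {y} → nextTip x ≡ just y → P (i , x) → P (i , y)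
    next x eq p = subst P (successor-just x eq) (step _ p)
    First : Fin 3 → Set
    First k = P (k , firstTip (branch H k))
    to-next : ∀ k z → P (k , z) → First (nextBranch H k)
    to-next k z p = subst P (successor-last k) (step _ (reach-lastTip (λ t → P (k , t)) next z p))
    advance : ∀ k → First k → First (nextBranch H k)
    advance k = to-next k _
    first-zero : ∀ k → First (nextBranch H k) → First zero
    first-zero zero             = advance (suc (suc zero)) ∘ advance (suc zero)
    first-zero (suc zero)       = advance (suc (suc zero))
    first-zero (suc (suc zero)) = id
    first : ∀ k → First zero → First k
    first zero             = id
    first (suc zero)       = advance zero
    first (suc (suc zero)) = advance (suc zero) ∘ advance zero

-- Claws of a treelike graph

module _ (H : CubicHalin) (A : Leaf H → FourPole) where

  private
    X : Graph
    X = treelike H A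

  module _ {p y : Leaf H} (eq : successor H p ≡ y) (j : Fin 2) where

    -- The pole of `p` stands between `p` and its successor `y`, so its right joins meet the left
    -- joins of the pole of `y` at the twins of `y`.
    twinClaw : Claw X (twin y j) (twin y j) (join y left j) (join p right j)
    twinClaw = record
      { incident₁ = inj₂ refl ; incident₂ = inj₂ refl ; incident₃ = inj₂ (cong (λ z → twin z j) (sym eq))
      ; distinct₁₂ = λ () ; distinct₁₃ = λ () ; distinct₂₃ = λ () }

  child-incident : ∀ {i p q} → parent q ≡ just p → Incident X (tree (below i p)) (tree (i , q))
  child-incident eq rewrite eq = inj₂ refl

  leafClaw : ∀ x → Claw X (tree (leafVertex H x)) (tree (proj₁ x , tipNode (proj₂ x))) (twin x zero) (twin x (suc zero))
  leafClaw x = record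
    { incident₁ = inj₁ refl ; incident₂ = inj₁ refl ; incident₃ = inj₁ refl
    ; distinct₁₂ = λ () ; distinct₁₃ = λ () ; distinct₂₃ = λ () }

  forkClaw : ∀ {i a b} (S : Subtree (branch H i) (fork a b)) →
             Claw X (tree (below i (node S top)))
               (tree (i , node S top)) (tree (i , node S (inˡ top))) (tree (i , node S (inʳ top)))
  forkClaw S = record
    { incident₁ = inj₁ refl
    ; incident₂ = child-incident (parent-node S refl)
    ; incident₃ = child-incident (parent-node S refl)
    ; distinct₁₂ = λ eq → top≢inˡ (node-injective S (same eq))
    ; distinct₁₃ = λ eq → top≢inʳ (node-injective S (same eq))
    ; distinct₂₃ = λ eq → inˡ≢inʳ (node-injective S (same eq))
    }
    where
    same : ∀ {i} {p q : Node (branch H i)} → _≡_ {A = TreelikeEdge H A} (tree (i , p)) (tree (i , q)) → p ≡ q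
    same refl = refl
    top≢inˡ : ∀ {a b} {p : Node a} → Node.top {fork a b} ≢ inˡ p
    top≢inˡ ()
    top≢inʳ : ∀ {a b} {p : Node b} → Node.top {fork a b} ≢ inʳ p
    top≢inʳ ()
    inˡ≢inʳ : ∀ {a b} {p : Node a} {q : Node b} → Node.inˡ p ≢ inʳ q
    inˡ≢inʳ ()

-- Odd functions and colourings on poles and tree edges

module _ (H : CubicHalin) (A : Leaf H → FourPole) (cubic : Cubic (treelike H A))
         (frumious : ∀ x → Frumious (closure (A x))) where

  private
    X : Graph
    X = treelike H A

  -- The value f(p) of the overview, read off on the left; `across-right` shows that the right gives
  -- the same.
  across : (TreelikeEdge H A → Bool) → Leaf H → Bool
  across f x = f (join x left zero) xor f (join x left (suc zero))

  module _ (x : Leaf H) where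

    private
      Y : Graph
      Y = closure (A x)

      -- The value at uv is irrelevant, except that it keeps `lift` injective.
      lift : ClosureEdge (A x) → TreelikeEdge H A
      lift (old e)    = pole x e
      lift (join s j) = join x s j
      lift uv         = tree (zero , top)

      lift-injective : ∀ {e f} → lift e ≡ lift f → e ≡ f
      lift-injective {old _}    {old _}    refl = refl
      lift-injective {join _ _} {join _ _} refl = refl
      lift-injective {uv}       {uv}       _    = refl

      lift-incident : ∀ {w} e → Incident Y (old w) e → Incident X (pole x w) (lift e)
      lift-incident (old _)    (inj₁ refl) = inj₁ refl
      lift-incident (old _)    (inj₂ refl) = inj₂ refl
      lift-incident (join _ _) (inj₂ refl) = inj₁ refl
      lift-incident uv         (inj₁ ())
      lift-incident uv         (inj₂ ())

      lift-claw : ∀ {w e f g} → Claw Y (old w) e f g → Claw X (pole x w) (lift e) (lift f) (lift g)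
      lift-claw {e = e} {f} {g} c = record
        { incident₁  = lift-incident e (incident₁ c)
        ; incident₂  = lift-incident f (incident₂ c)
        ; incident₃  = lift-incident g (incident₃ c)
        ; distinct₁₂ = distinct₁₂ c ∘ lift-injective
        ; distinct₁₃ = distinct₁₃ c ∘ lift-injective
        ; distinct₂₃ = distinct₂₃ c ∘ lift-injective
        }

      cubicʸ : Cubic Y
      cubicʸ = proj₁ (proj₂ (frumious x))

      apexClaw : ∀ s → Claw Y (apex s) (join s zero) (join s (suc zero)) uv
      apexClaw s = record
        { incident₁ = inj₁ refl ; incident₂ = inj₁ refl ; incident₃ = at-apex s
        ; distinct₁₂ = λ () ; distinct₁₃ = λ () ; distinct₂₃ = λ () }
        where
        at-apex : ∀ s → Incident Y (apex s) uv
        at-apex left  = inj₁ refl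
        at-apex right = inj₂ refl

    -- The value at `uv` is the one that oddness at `apex left` forces.
    extend : (TreelikeEdge H A → Bool) → ClosureEdge (A x) → Bool
    extend f (old e)    = f (pole x e)
    extend f (join s j) = f (join x s j)
    extend f uv         = not (across f x)

    private
      extend-lift : ∀ f {w} e → Incident Y (old w) e → extend f e ≡ f (lift e)
      extend-lift f (old _)    _         = refl
      extend-lift f (join _ _) _         = refl
      extend-lift f uv         (inj₁ ())
      extend-lift f uv         (inj₂ ())

    -- An old vertex sees the same three values as in the treelike graph, and `apex left` is odd by
    -- the choice at `uv`. Oddness at the one remaining vertex then comes for free.
    extend-odd : ∀ f → Odd X f → Odd Y (extend f)
    extend-odd f odd = odd-off⇒odd Y cubicʸ (extend f) (apex right) odd-off
      where
      balance : ∀ a b → a xor (b xor not (a xor b)) ≡ true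
      balance false false = refl
      balance false true  = refl
      balance true  false = refl
      balance true  true  = refl
      odd-at-old : ∀ {w e₁ e₂ e₃} → Claw Y (old w) e₁ e₂ e₃ → parity Y (extend f) (old w) ≡ true
      odd-at-old {w} {e₁} {e₂} {e₃} c = begin
        parity Y (extend f) (old w)
          ≡⟨ parity-claw Y cubicʸ (extend f) c ⟩
        extend f e₁ xor (extend f e₂ xor extend f e₃)
          ≡⟨ cong₂ _xor_ (extend-lift f e₁ (incident₁ c))
              (cong₂ _xor_ (extend-lift f e₂ (incident₂ c)) (extend-lift f e₃ (incident₃ c))) ⟩
        f (lift e₁) xor (f (lift e₂) xor f (lift e₃))
          ≡⟨ parity-claw X cubic f (lift-claw c) ⟨
        parity X f (pole x w)
          ≡⟨ odd (pole x w) ⟩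
        true ∎
        where open ≡-Reasoning
      odd-off : ∀ v → v ≢ apex right → parity Y (extend f) v ≡ true
      odd-off (old w)      _  = odd-at-old (proj₂ (proj₂ (proj₂ (claw-at Y cubicʸ (old w)))))
      odd-off (apex left)  _  = trans (parity-claw Y cubicʸ (extend f) (apexClaw left))
        (balance (f (join x left zero)) (f (join x left (suc zero))))
      odd-off (apex right) v≢ = contradiction refl v≢

    -- Oddness at the two ends of `uv` equates the sums over the left and the right joins.
    across-right : ∀ f → Odd X f → f (join x right zero) xor f (join x right (suc zero)) ≡ across f x
    across-right f odd = balanced (f (join x right zero)) (f (join x right (suc zero))) (across f x)
      (trans (sym (parity-claw Y cubicʸ (extend f) (apexClaw right)))
      (extend-odd f odd (apex right)))
      where
      balanced : ∀ a b c → a xor (b xor not c) ≡ true → a xor b ≡ c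
      balanced false false false _ = refl
      balanced false true  true  _ = refl
      balanced true  false true  _ = refl
      balanced true  true  false _ = refl

    module _ {M : EdgeSet X} (matching : PerfectMatching X M) {t : ℕ} (C : ColourSets X M t) where

      open ColourSets C

      -- At an old vertex the matching edge is inherited through `lift`. At an apex oddness leaves
      -- one or three matching edges, and the hypothesis excludes three.
      extend-matching : (∀ s → M (join x s zero) ∧ M (join x s (suc zero)) ≡ false) → PerfectMatching Y (extend M)
      extend-matching _ (old w) with matching (pole x w)
      ... | tree _     , (_ , inj₁ ()) , _
      ... | tree _     , (_ , inj₂ ()) , _
      ... | twin _ _   , (_ , inj₁ ()) , _
      ... | twin _ _   , (_ , inj₂ ()) , _
      ... | join _ s j , (_ , inj₂ ()) , _
      ... | pole _ e   , (Me , inj₁ refl) , unique = old e , (Me , inj₁ refl) ,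
        λ {f} (Mf , p) → lift-injective (unique (subst T (extend-lift M f p) Mf , lift-incident f p))
      ... | pole _ e   , (Me , inj₂ refl) , unique = old e , (Me , inj₂ refl) ,
        λ {f} (Mf , p) → lift-injective (unique (subst T (extend-lift M f p) Mf , lift-incident f p))
      ... | join _ s j , (Me , inj₁ refl) , unique = join s j , (Me , inj₂ refl) ,
        λ {f} (Mf , p) → lift-injective (unique (subst T (extend-lift M f p) Mf , lift-incident f p))
      extend-matching not-both (apex s) = claw-matched Y cubicʸ (extend M) (apexClaw s)
        (trans (sym (parity-claw Y cubicʸ (extend M) (apexClaw s)))
               (extend-odd M (matching-odd X cubic M matching t) (apex s)))
        (not-both s)

      -- The shape at `uv` is all that the restricted colouring lacks to be a colouring of the
      -- closure with the same `t`, which frumiousness forbids.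
      pole-not-extendable : (∀ s → M (join x s zero) ∧ M (join x s (suc zero)) ≡ false) →
                            ¬ Shape (not (across M x)) (λ a → not (across (λ e → colours e a) x))
      pole-not-extendable not-both shape-uv = proj₂ (proj₂ (frumious x)) (extend M) matchingʸ t
        (colourable⇒classI Y cubicʸ (extend M) matchingʸ t (apex left)
          (colourSets⇒colourable Y cubicʸ (extend M) matchingʸ t record
            { colours = λ e a → extend (λ f → colours f a) e
            ; odd     = λ a → extend-odd (λ e → colours e a) (odd a)
            ; shape   = λ { (old e) → shape (pole x e) ; (join s j) → shape (join x s j) ; uv → shape-uv }
            }))
        where
        matchingʸ : PerfectMatching Y (extend M)
        matchingʸ = extend-matching not-both

  -- The tree edge e separates the circuit at the poles p and q.
  record Linked (e : TreeEdge H) (p q : Leaf H) : Set where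
    constructor linked
    field
      value : ∀ f → Odd X f → f (tree e) ≡ not (across f p xor across f q)

  open Linked

  linked-sym : ∀ {e p q} → Linked e p q → Linked e q p
  linked-sym {e} {p} {q} link = linked λ f odd → trans (value link f odd) (cong not (swap (across f p) (across f q)))
    where
    swap : ∀ a b → a xor b ≡ b xor a
    swap = solve 2 (λ a b → a :+ b := b :+ a) refl
      where open xor-∧-Solver

  private
    solve-odd : ∀ f {v e₁ e₂ e₃} → Odd X f → Claw X v e₁ e₂ e₃ → f e₁ ≡ not (f e₂ xor f e₃)
    solve-odd f {v} {e₁} {e₂} {e₃} odd c = xor-solve (f e₁) (f e₂) (f e₃) (trans (sym (parity-claw X cubic f c)) (odd v))

  -- The leaf edge is determined by the two twin edges, and each twin edge by the two joins at its
  -- twin; these joins are the right pair of `p` and the left pair of `y`.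
  link-leaf : ∀ {p y} → successor H p ≡ y → Linked (proj₁ y , tipNode (proj₂ y)) p y
  link-leaf {p} {y} eq .value f odd = begin
    f (tree (proj₁ y , tipNode (proj₂ y)))
      ≡⟨ solve-odd f odd (leafClaw H A y) ⟩
    not (f (twin y zero) xor f (twin y (suc zero)))
      ≡⟨ cong not (cong₂ _xor_ (solve-odd f odd (twinClaw H A eq zero)) (solve-odd f odd (twinClaw H A eq (suc zero)))) ⟩
    not (not (f (join y left zero) xor f (join p right zero)) xor not (f (join y left (suc zero)) xor f (join p right (suc zero))))
      ≡⟨ regroup (f (join y left zero)) (f (join p right zero)) (f (join y left (suc zero))) (f (join p right (suc zero))) ⟩
    not ((f (join p right zero) xor f (join p right (suc zero))) xor across f y)
      ≡⟨ cong (λ b → not (b xor across f y)) (across-right p f odd) ⟩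
    not (across f p xor across f y) ∎
    where
    open ≡-Reasoning
    regroup : ∀ l₀ r₀ l₁ r₁ → not (not (l₀ xor r₀) xor not (l₁ xor r₁)) ≡ not ((r₀ xor r₁) xor (l₀ xor l₁))
    regroup = solve 4 (λ l₀ r₀ l₁ r₁ →
      con true :+ ((con true :+ (l₀ :+ r₀)) :+ (con true :+ (l₁ :+ r₁))) := con true :+ ((r₀ :+ r₁) :+ (l₀ :+ l₁))) refl
      where open xor-∧-Solver

  -- The poles before the first and after the last leaf of the subtree are those that its top edge
  -- separates. At a fork the pole `m` between the two parts enters both links and cancels modulo 2.
  link-subtree : ∀ {i b} (S : Subtree (branch H i) b) p → successor H p ≡ (i , tips S (firstTip b)) →
                 Linked (i , node S top) p (i , tips S (lastTip b))
  link-subtree {i} {leaf} S p eq = subst (λ n → Linked (i , n) p (i , tips S tip)) (tipNode-tips S tip) (link-leaf eq)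
  link-subtree {i} {fork a b} S p eq .value f odd = begin
    f (tree (i , node S top))
      ≡⟨ solve-odd f odd (forkClaw H A S) ⟩
    not (f (tree (i , node S (inˡ top))) xor f (tree (i , node S (inʳ top))))
      ≡⟨ cong not (cong₂ _xor_ (value (link-subtree (leftPart S) p eq) f odd)
           (value (link-subtree (rightPart S) (i , tips S (inˡ (lastTip a))) (successor-across H S)) f odd)) ⟩
    not (not (across f p xor across f m) xor not (across f m xor across f q))
      ≡⟨ telescope (across f p) (across f m) (across f q) ⟩
    not (across f p xor across f q) ∎
    where
    open ≡-Reasoning
    m = i , tips S (inˡ (lastTip a))
    q = i , tips S (inʳ (lastTip b))
    telescope : ∀ p m q → not (not (p xor m) xor not (m xor q)) ≡ not (p xor q)
    telescope = solve 3 (λ p m q →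
      con true :+ ((con true :+ (p :+ m)) :+ (con true :+ (m :+ q))) := con true :+ (p :+ q)) refl
      where open xor-∧-Solver

  -- A triangle at x of the triangulated polygon dual to the tree, whose
  -- vertices are the poles.
  record Corner (x : Leaf H) : Set where
    field
      vertex    : TreelikeVertex H A
      e₁ e₂     : TreeEdge H
      q₁ q₂     : Leaf H
      incident₁ : Incident X vertex (tree e₁)
      incident₂ : Incident X vertex (tree e₂)
      distinct  : _≢_ {A = TreelikeEdge H A} (tree e₁) (tree e₂)
      linked₁   : Linked e₁ x q₁
      linked₂   : Linked e₂ x q₂

  -- The corner sits at the fork where `x` is the last leaf of the left part: both child edges there
  -- separate the pole of `x` from another one. No fork of the subtree does this for its very last
  -- leaf.
  corner-in-subtree : ∀ {i b} (S : Subtree (branch H i) b) p → successor H p ≡ (i , tips S (firstTip b)) →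
                      ∀ x → x ≡ lastTip b ⊎ Corner (i , tips S x)
  corner-in-subtree S p eq tip = inj₁ refl
  corner-in-subtree {i} {fork a b} S p eq (inˡ x) with corner-in-subtree (leftPart S) p eq x
  ... | inj₂ corner = inj₂ corner
  ... | inj₁ refl   = inj₂ record
    { vertex    = tree (below i (node S top))
    ; e₁        = i , node S (inˡ top)
    ; e₂        = i , node S (inʳ top)
    ; q₁        = p
    ; q₂        = i , tips S (inʳ (lastTip b))
    ; incident₁ = incident₂ (forkClaw H A S)
    ; incident₂ = incident₃ (forkClaw H A S)
    ; distinct  = distinct₂₃ (forkClaw H A S)
    ; linked₁   = linked-sym (link-subtree (leftPart S) p eq)
    ; linked₂   = link-subtree (rightPart S) (i , tips S (inˡ (lastTip a))) (successor-across H S)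
    }
  corner-in-subtree {i} {fork a b} S p eq (inʳ x)
    with corner-in-subtree (rightPart S) (i , tips S (inˡ (lastTip a))) (successor-across H S) x
  ... | inj₂ corner = inj₂ corner
  ... | inj₁ refl   = inj₁ refl

  root-link : ∀ i → Linked (i , top) (lastLeaf H (previousBranch H i)) (lastLeaf H i)
  root-link i = link-subtree whole (lastLeaf H (previousBranch H i)) (successor-previous H i)

  corner : ∀ x → Corner x
  corner (i , x) with corner-in-subtree whole (lastLeaf H (previousBranch H i)) (successor-previous H i) x
  ... | inj₂ c    = c
  -- For the last leaf of a branch the corner is at the root, between this branch and the next.
  ... | inj₁ refl = record
    { vertex    = tree root
    ; e₁        = i , top
    ; e₂        = nextBranch H i , top
    ; q₁        = lastLeaf H (previousBranch H i)
    ; q₂        = lastLeaf H (nextBranch H i)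
    ; incident₁ = inj₂ refl
    ; incident₂ = inj₂ refl
    ; distinct  = distinct i
    ; linked₁   = linked-sym (root-link i)
    ; linked₂   = subst (λ k → Linked (nextBranch H i , top) (lastLeaf H k) (lastLeaf H (nextBranch H i)))
                    (previous-next i) (root-link (nextBranch H i))
    }
    where
    previous-next : ∀ i → previousBranch H (nextBranch H i) ≡ i
    previous-next zero             = refl
    previous-next (suc zero)       = refl
    previous-next (suc (suc zero)) = refl
    distinct : ∀ i → _≢_ {A = TreelikeEdge H A} (tree (i , top)) (tree (nextBranch H i , top))
    distinct zero             ()
    distinct (suc zero)       ()
    distinct (suc (suc zero)) ()

  -- No colouring of a treelike graph exists

  module _ {M : EdgeSet X} (matching : PerfectMatching X M) {t : ℕ} (C : ColourSets X M t) where

    open ColourSets C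

    private
      χ : Fin (3 + t) → TreelikeEdge H A → Bool
      χ a e = colours e a

      M-odd : Odd X M
      M-odd = matching-odd X cubic M matching t

      single : ∀ {e} → M e ≡ false → Shape false (colours e)
      single {e} Me = subst (λ b → Shape b (colours e)) Me (shape e)

    -- The two edges of a corner meet, so at least one of them is off `M`.
    unmatched-link : ∀ x → ∃ λ e → ∃ λ q → M (tree e) ≡ false × Linked e x q
    unmatched-link x with c ← corner x with M (tree (Corner.e₁ c)) in M₁
    ... | false = _ , _ , M₁ , Corner.linked₁ c
    ... | true  = _ , _
      , unmatched X cubic M matching t (Corner.incident₁ c) (Corner.incident₂ c) (Corner.distinct c) M₁
      , Corner.linked₂ c

    private
      differ : ∀ a b → false ≡ not (a xor b) → b ≡ not a
      differ false true  _ = refl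
      differ true  false _ = refl

      odd⇒not-both : ∀ a b → a xor b ≡ true → a ∧ b ≡ false
      odd⇒not-both false _     _ = refl
      odd⇒not-both true  false _ = refl

      even⇒equal : ∀ a b → a xor b ≡ false → a ≡ b
      even⇒equal false false _ = refl
      even⇒equal true  true  _ = refl

    Empty : Leaf H → Set
    Empty x = ∀ s j → M (join x s j) ≡ false

    empty⇒across-false : ∀ {x} → Empty x → ∀ a → across (χ a) x ≡ false
    empty⇒across-false {x} empty with single (empty left zero) | single (empty left (suc zero))
    ... | i , χ₀ | j , χ₁ with i ≟ᶠ j
    ...   | yes refl = λ a → trans (cong₂ _xor_ (χ₀ a) (χ₁ a)) (self (δ i a))
      where
      self : ∀ b → b xor b ≡ false
      self false = refl
      self true  = refl
    -- With different colours `i` and `j` on the left, `uv` would receive all colours but these two,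
    -- as befits an edge in the extended matching.
    ...   | no i≢j   = ⊥-elim (pole-not-extendable x matching C
      (λ s → cong (_∧ M (join x s (suc zero))) (empty s zero))
      (subst (λ b → Shape b (λ a → not (across (χ a) x)))
        (cong not (sym (cong₂ _xor_ (empty left zero) (empty left (suc zero)))))
        (i , j , i≢j , λ a → cong not (cong₂ _xor_ (χ₀ a) (χ₁ a)))))

    -- An unmatched tree edge `e` separates `x` from some `q`. Since every colour and `M` vanish
    -- across `x`, the edge `uv` of the closure of `q` is off the extended matching and would
    -- receive the single colour of `e`.
    no-empty : ∀ x → ¬ Empty x
    no-empty x empty with e , q , Me , link ← unmatched-link x = pole-not-extendable q matching C not-both
      (subst (λ b → Shape b (λ a → not (across (χ a) q))) (sym (cong not across-q)) shape-q)
      where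
      across-q : across M q ≡ true
      across-q = trans (differ (across M x) (across M q) (trans (sym Me) (value link M M-odd)))
        (cong not (cong₂ _xor_ (empty left zero) (empty left (suc zero))))
      not-both : ∀ s → M (join q s zero) ∧ M (join q s (suc zero)) ≡ false
      not-both left  = odd⇒not-both (M (join q left zero)) (M (join q left (suc zero))) across-q
      not-both right = odd⇒not-both (M (join q right zero)) (M (join q right (suc zero))) (trans (across-right q M M-odd) across-q)
      shape-q : Shape false (λ a → not (across (χ a) q))
      shape-q with i , χe ← single Me = i , λ a → trans
        (sym (trans (value link (χ a) (odd a)) (cong (λ b → not (b xor across (χ a) q)) (empty⇒across-false empty a)))) (χe a)

    JoinsAre : Side → Bool → Leaf H → Set
    JoinsAre s b x = ∀ j → M (join x s j) ≡ b

    private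
      uniform : ∀ s x → M (join x s zero) xor M (join x s (suc zero)) ≡ false →
                ∀ {b} → M (join x s zero) ≡ b → JoinsAre s b x
      uniform s x even eq zero       = eq
      uniform s x even eq (suc zero) = trans (sym (even⇒equal (M (join x s zero)) (M (join x s (suc zero))) even)) eq

      even-across : ∀ s x {b} → JoinsAre s b x → across M x ≡ false
      even-across left  x {b} l = trans (cong₂ _xor_ (l zero) (l (suc zero))) (xor-same b)
      even-across right x {b} r = trans (sym (across-right x M M-odd)) (trans (cong₂ _xor_ (r zero) (r (suc zero))) (xor-same b))

      not-both-unmatched : ∀ x → JoinsAre left false x → ¬ JoinsAre right false x
      not-both-unmatched x l r = no-empty x λ { left → l ; right → r }

      -- The joins of x on the right and those of its successor on the left
      -- meet at the twins of the successor.
      left⇒right : ∀ x → JoinsAre left true (successor H x) → JoinsAre right false x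
      left⇒right x l j = unmatched X cubic M matching t (incident₂ c) (incident₃ c) (distinct₂₃ c) (l j)
        where c = twinClaw H A {x} refl j

      right⇒left : ∀ x → JoinsAre right true x → JoinsAre left false (successor H x)
      right⇒left x r j = unmatched X cubic M matching t (incident₃ c) (incident₂ c) (distinct₂₃ c ∘ sym) (r j)
        where c = twinClaw H A {x} refl j

    -- The right joins of `x` are both in `M` or both off it. The latter would make `x` empty, and
    -- the former blocks the left joins of the successor.
    left-unmatched-step : ∀ x → JoinsAre left false x → JoinsAre left false (successor H x)
    left-unmatched-step x l = step (M (join x right zero)) refl
      where
      r : ∀ {b} → M (join x right zero) ≡ b → JoinsAre right b x
      r = uniform right x (trans (across-right x M M-odd) (even-across left x l))
      step : ∀ b → M (join x right zero) ≡ b → JoinsAre left false (successor H x)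
      step false r₀ = ⊥-elim (not-both-unmatched x l (r r₀))
      step true  r₀ = right⇒left x (r r₀)

    -- The matched joins of the successor block the right joins of `x`; by evenness its left joins
    -- are then both in `M` or both off it, and again `x` is not empty.
    left-matched-step : ∀ x → JoinsAre left true (successor H x) → JoinsAre left true x
    left-matched-step x l′ = step (M (join x left zero)) refl
      where
      r : JoinsAre right false x
      r = left⇒right x l′
      step : ∀ b → M (join x left zero) ≡ b → JoinsAre left true x
      step false l₀ = ⊥-elim (not-both-unmatched x (uniform left x (even-across right x r) l₀) r)
      step true  l₀ = uniform left x (even-across right x r) l₀

    across-constant : ∀ z y → across M z ≡ false → across M y ≢ true
    across-constant z y Mz My = step (M (join z left zero)) refl
      where
      y-not-uniform : ∀ {b} → ¬ JoinsAre left b y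
      y-not-uniform l with () ← trans (sym My) (even-across left y l)
      step : ∀ b → M (join z left zero) ≡ b → ⊥
      step false l₀ = y-not-uniform
        (leaf-induction H (JoinsAre left false) left-unmatched-step {z} (uniform left z Mz l₀) y)
      -- Induction only runs forwards, so the backward step is used in contraposition, leading from
      -- `y` to `z`.
      step true  l₀ = leaf-induction H (λ x → ¬ JoinsAre left true x)
        (λ x ¬l l → ¬l (left-matched-step x l)) {y} y-not-uniform z (uniform left z Mz l₀)

    treelike-not-coloured : ⊥
    treelike-not-coloured = let e , q , Me , link = unmatched-link x in step q (across M x) refl
      (differ (across M x) (across M q) (trans (sym Me) (value link M M-odd)))
      where
      x : Leaf H
      -- An arbitrary leaf: any pole has an unmatched link, whose two poles differ in their value of
      -- `M`.
      x = lastLeaf H zero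
      step : ∀ q b → across M x ≡ b → across M q ≡ not (across M x) → ⊥
      step q false Mx Mq = across-constant x q Mx (trans Mq (cong not Mx))
      step q true  Mx Mq = across-constant q x (trans Mq (cong not Mx)) Mx

-- 2-edge-connectedness of treelike graphs

Path : (G : Graph) → (Edge G → Set) → Vertex G → Vertex G → Set
Path G P = Star (λ u v → Σ[ e ∈ Edge G ] P e × Joins G e u v)

module _ {G : Graph} {P : Edge G → Set} where

  path-sym : ∀ {u v} → Path G P u v → Path G P v u
  path-sym = reverse λ { (e , p , inj₁ j) → e , p , inj₂ j ; (e , p , inj₂ j) → e , p , inj₁ j }

  path-edge : ∀ e → P e → Path G P (proj₁ (ends G e)) (proj₂ (ends G e))
  path-edge e p = (e , p , inj₁ refl) ◅ ε

path-map : ∀ {G H P Q} (f : Vertex G → Vertex H) →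
           (∀ e → P e → Path H Q (f (proj₁ (ends G e))) (f (proj₂ (ends G e)))) →
           ∀ {u v} → Path G P u v → Path H Q (f u) (f v)
path-map {H = H} {Q = Q} f step = kleisliStar f λ
  { (e , p , inj₁ refl) → step e p
  ; (e , p , inj₂ refl) → path-sym {H} {Q} (step e p)
  }

module _ (H : CubicHalin) (A : Leaf H → FourPole) (bridgeless : ∀ x → Bridgeless (closure (A x))) where

  private
    X : Graph
    X = treelike H A

  _≟ˡ_ : DecidableEquality (Leaf H)
  _≟ˡ_ = finite⇒≟ (finite-Σ (finite-Fin 3) (finite-Tip ∘ branch H))

  child-joins : ∀ {i p q} → parent q ≡ just p → Joins X (tree (i , q)) (tree (below i q)) (tree (below i p))
  child-joins eq rewrite eq = inj₁ refl

  module _ (e : TreelikeEdge H A) where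

    private
      infix 4 _⇝_
      _⇝_ : TreelikeVertex H A → TreelikeVertex H A → Set
      _⇝_ = Path X (_≢ e)

      back : ∀ {u v} → u ⇝ v → v ⇝ u
      back = path-sym {X} {_≢ e}

      along : ∀ f → f ≢ e → proj₁ (treelikeEnds H A f) ⇝ proj₂ (treelikeEnds H A f)
      along = path-edge {X} {_≢ e}

      leafAt : Leaf H → TreelikeVertex H A
      leafAt x = tree (leafVertex H x)

    -- A path in the closure of a pole that avoids this edge can be followed
    -- in the treelike graph without using e, apart from the edge uv.
    record Detour (x : Leaf H) : Set where
      field
        avoided   : ClosureEdge (A x)
        pole-safe : ∀ f → old f ≢ avoided → pole x f ≢ e
        join-safe : ∀ s j → join s j ≢ avoided → join x s j ≢ e × twin (circuitEnd H A x s) j ≢ e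

    open Detour

    -- An apex goes to the leaf beyond the twins, so each `join` edge turns into a path of length
    -- two through a twin.
    image : ∀ x → ClosureVertex (A x) → TreelikeVertex H A
    image x (old w)  = pole x w
    image x (apex s) = leafAt (circuitEnd H A x s)

    follow : ∀ {x} (d : Detour x) → (uv ≢ avoided d → leafAt x ⇝ leafAt (successor H x)) →
             ∀ u v → image x u ⇝ image x v
    follow {x} d uv-path u v =
      path-map {closure (A x)} {X} {_≢ avoided d} {_≢ e} (image x) step (proj₂ (bridgeless x) (avoided d) u v)
      where
      step : ∀ f → f ≢ avoided d → image x (proj₁ (ends (closure (A x)) f)) ⇝ image x (proj₂ (ends (closure (A x)) f))
      step (old f)    f≢ = along (pole x f) (pole-safe d f f≢)
      step (join s j) f≢ = along (twin _ j) (proj₂ (join-safe d s j f≢))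
                        ◅◅ back (along (join x s j) (proj₁ (join-safe d s j f≢)))
      step uv         f≢ = uv-path f≢

    -- The paths that replace the edges of the closure other than `uv` are edge-disjoint, so `e`
    -- spoils at most one of them.
    detour : ∀ x → Detour x
    detour x = go e refl
      where
      twin-leaf : ∀ {a b i j} → _≡_ {A = TreelikeEdge H A} (twin a i) (twin b j) → a ≡ b
      twin-leaf refl = refl
      twin-index : ∀ {a b i j} → _≡_ {A = TreelikeEdge H A} (twin a i) (twin b j) → i ≡ j
      twin-index refl = refl
      nothing-on-pole : (∀ f → pole x f ≢ e) → (∀ s j → join x s j ≢ e × twin (circuitEnd H A x s) j ≢ e) → Detour x
      -- If `e` spoils none of these paths, `uv` is avoided instead, and then `follow` requires no
      -- path between the two leaves.
      nothing-on-pole p j = record { avoided = uv ; pole-safe = λ f _ → p f ; join-safe = λ s i _ → j s i }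
      go : ∀ e′ → e ≡ e′ → Detour x
      go (tree _) refl = nothing-on-pole (λ _ ()) (λ _ _ → (λ ()) , (λ ()))
      go (pole z f₀) refl with x ≟ˡ z
      ... | yes refl = record
        { avoided   = old f₀
        ; pole-safe = λ { _ f≢ refl → f≢ refl }
        ; join-safe = λ _ _ _ → (λ ()) , (λ ()) }
      ... | no x≢z   = nothing-on-pole (λ { _ refl → x≢z refl }) (λ _ _ → (λ ()) , (λ ()))
      go (join z s₀ j₀) refl with x ≟ˡ z
      ... | yes refl = record
        { avoided   = join s₀ j₀
        ; pole-safe = λ _ _ ()
        ; join-safe = λ _ _ f≢ → (λ { refl → f≢ refl }) , (λ ()) }
      ... | no x≢z   = nothing-on-pole (λ _ ()) (λ _ _ → (λ { refl → x≢z refl }) , (λ ()))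
      -- A twin edge of `y` serves two poles: that of `y` on the left and that of its predecessor on
      -- the right.
      go (twin y j₀) refl with x ≟ˡ y | successor H x ≟ˡ y
      ... | yes refl | _       = record
        { avoided   = join left j₀
        ; pole-safe = λ _ _ ()
        ; join-safe = λ { left _ f≢ → (λ ()) , (λ { refl → f≢ refl })
                        ; right _ _ → (λ ()) , (λ eq → successor-irreflexive H x (twin-leaf eq)) } }
      ... | no x≢y   | yes sx≡y = record
        { avoided   = join right j₀
        ; pole-safe = λ _ _ ()
        ; join-safe = λ { left _ _ → (λ ()) , (λ eq → x≢y (twin-leaf eq))
                        ; right _ f≢ → (λ ()) , (λ eq → f≢ (cong (join right) (twin-index eq))) } }
      ... | no x≢y   | no sx≢y  = nothing-on-pole (λ _ ())
        (λ { left _ → (λ ()) , (λ eq → x≢y (twin-leaf eq)) ; right _ → (λ ()) , (λ eq → sx≢y (twin-leaf eq)) })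

    module _ (e-not-tree : ∀ f → tree f ≢ e) where

      private
        up : ∀ {i b} (S : Subtree (branch H i) b) p → tree (below i (node S p)) ⇝ tree (below i (node S top))
        up S top     = ε
        up S (inˡ p) = up (leftPart S) p ◅◅ (_ , e-not-tree _ , child-joins (parent-node S refl)) ◅ ε
        up S (inʳ p) = up (rightPart S) p ◅◅ (_ , e-not-tree _ , child-joins (parent-node S refl)) ◅ ε

        tree-to-root : ∀ v → tree v ⇝ tree root
        tree-to-root root        = ε
        tree-to-root (below i p) = up whole p ◅◅ along (tree (i , top)) (e-not-tree _)

        pole-to-root : ∀ x w → pole x w ⇝ tree root
        pole-to-root x w =
          follow (detour x)
            -- The tree is intact, so a tree path between the two leaves stands in for `uv`.
            (λ _ → tree-to-root (leafVertex H x) ◅◅ back (tree-to-root (leafVertex H (successor H x))))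
            (old w) (apex left)
            ◅◅ tree-to-root (leafVertex H x)

        to-root : ∀ v → v ⇝ tree root
        to-root (tree v)   = tree-to-root v
        to-root (pole x w) = pole-to-root x w
        -- If the removed edge is the one from the leaf to this twin, the path leaves through the
        -- pole of `y`.
        to-root (twin y j) = [ via-join , via-twin ]′ (toSum (finite⇒≟ (finiteEdge X) (twin y j) e))
          where
          via-twin : twin y j ≢ e → twin y j ⇝ tree root
          via-twin twin≢e = back (along (twin y j) twin≢e) ◅◅ tree-to-root (leafVertex H y)
          join≢twin : ∀ {s i z k} → _≢_ {A = TreelikeEdge H A} (join z s i) (twin y k)
          join≢twin ()
          via-join : twin y j ≡ e → twin y j ⇝ tree root
          via-join twin≡e = back (along (join y left j) (λ join≡e → join≢twin (trans join≡e (sym twin≡e))))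
                         ◅◅ pole-to-root y (end (A y) left j)

      connected-without-nontree : ConnectedVia X (_≢ e)
      connected-without-nontree u v = to-root u ◅◅ back (to-root v)

  module _ (e₀ : TreeEdge H) where

    private
      infix 4 _⇝_
      _⇝_ : TreelikeVertex H A → TreelikeVertex H A → Set
      _⇝_ = Path X (_≢ tree e₀)

      back : ∀ {u v} → u ⇝ v → v ⇝ u
      back = path-sym {X} {_≢ tree e₀}

      along : ∀ f → f ≢ tree e₀ → proj₁ (treelikeEnds H A f) ⇝ proj₂ (treelikeEnds H A f)
      along = path-edge {X} {_≢ tree e₀}

      leafAt : Leaf H → TreelikeVertex H A
      leafAt x = tree (leafVertex H x)

      -- For a removed tree edge the detour avoids `uv`, so the pole by itself connects the leaves
      -- on its two sides.
      along-pole : ∀ x u v → image (tree e₀) x u ⇝ image (tree e₀) x v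
      along-pole x = follow (tree e₀) (detour (tree e₀) x) (λ uv≢uv → contradiction refl uv≢uv)

      leaves-connected : ∀ x y → leafAt x ⇝ leafAt y
      leaves-connected x = leaf-induction H (λ y → leafAt x ⇝ leafAt y)
        (λ y path → path ◅◅ along-pole y (apex left) (apex right)) {x} ε

      one-differs : ∀ {e f : TreelikeEdge H A} → e ≢ f → e ≢ tree e₀ ⊎ f ≢ tree e₀
      one-differs {e} e≢f = [ (λ e≡e₀ → inj₂ (λ f≡e₀ → e≢f (trans e≡e₀ (sym f≡e₀)))) , inj₁ ]′
        (toSum (finite⇒≟ (finiteEdge X) e (tree e₀)))

      -- At each inner vertex at most one of the edges to the children is removed.
      down : ∀ {i b} (S : Subtree (branch H i) b) →
             ∃ λ x → tree (below i (node S top)) ⇝ tree (below i (node S (tipNode x)))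
      down {b = leaf}     S = tip , ε
      down {i} {fork a b} S = [ go-left , go-right ]′ (one-differs (distinct₂₃ (forkClaw H A S)))
        where
        Goal : Set
        Goal = ∃ λ x → tree (below i (node S top)) ⇝ tree (below i (node S (tipNode x)))
        go-left : tree (i , node S (inˡ top)) ≢ tree e₀ → Goal
        go-left e≢e₀ = let x , path = down (leftPart S) in
          inˡ x , back ((_ , e≢e₀ , child-joins (parent-node S refl)) ◅ ε) ◅◅ path
        go-right : tree (i , node S (inʳ top)) ≢ tree e₀ → Goal
        go-right e≢e₀ = let x , path = down (rightPart S) in
          inʳ x , back ((_ , e≢e₀ , child-joins (parent-node S refl)) ◅ ε) ◅◅ path

      node-to-leaf : ∀ {i b} (S : Subtree (branch H i) b) p →
                     ∃ λ x → tree (below i (node S p)) ⇝ tree (below i (node S (tipNode x)))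
      node-to-leaf S top     = down S
      node-to-leaf S (inˡ p) = let x , path = node-to-leaf (leftPart S) p in inˡ x , path
      node-to-leaf S (inʳ p) = let x , path = node-to-leaf (rightPart S) p in inʳ x , path

      branch-to-leaf : ∀ i p → ∃ λ x → tree (below i p) ⇝ leafAt x
      branch-to-leaf i p = let x , path = node-to-leaf whole p in (i , x) , path

      root-to-leaf : ∀ i → tree (i , top) ≢ tree e₀ → ∃ λ x → tree root ⇝ leafAt x
      root-to-leaf i e≢e₀ = let x , path = branch-to-leaf i top in x , back (along (tree (i , top)) e≢e₀) ◅◅ path

      to-leaf : ∀ v → ∃ λ x → v ⇝ leafAt x
      -- At most one of two edges at the root is the removed one.
      to-leaf (tree root)        = [ root-to-leaf zero , root-to-leaf (suc zero) ]′
        (one-differs {tree (zero , top)} {tree (suc zero , top)} (λ ()))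
      to-leaf (tree (below i p)) = branch-to-leaf i p
      to-leaf (twin y j)         = y , back (along (twin y j) (λ ()))
      to-leaf (pole x w)         = x , along-pole x (old w) (apex left)

    connected-without-tree : ConnectedVia X (_≢ tree e₀)
    connected-without-tree u v =
      let x , u⇝x = to-leaf u ; y , v⇝y = to-leaf v in u⇝x ◅◅ leaves-connected x y ◅◅ back v⇝y

  treelike-bridgeless : Bridgeless X
  -- Connectedness is inherited from the graph with some edge removed.
  treelike-bridgeless = (λ u v → gmap id (λ (f , _ , joins) → f , tt , joins) (without (tree (zero , top)) u v)) , without
    where
    without : ∀ e → ConnectedVia X (_≢ e)
    without (tree e₀)      = connected-without-tree e₀
    without e@(twin _ _)   = connected-without-nontree e (λ _ ())
    without e@(pole _ _)   = connected-without-nontree e (λ _ ())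
    without e@(join _ _ _) = connected-without-nontree e (λ _ ())

-- Invariance under isomorphism

module Isomorphism {G H : Graph} (φ : G ≅ H) where

  open _≅_ φ
  open Inverse

  vertex : Vertex G → Vertex H
  vertex = to vertices

  edge : Edge G → Edge H
  edge = to edges

  incident-map : ∀ {v} e → Incident G v e → Incident H (vertex v) (edge e)
  incident-map e p with joins e _ _ (inj₁ refl) | p
  ... | inj₁ eq | inj₁ refl = inj₁ (cong proj₁ (sym eq))
  ... | inj₁ eq | inj₂ refl = inj₂ (cong proj₂ (sym eq))
  ... | inj₂ eq | inj₁ refl = inj₂ (cong proj₂ (sym eq))
  ... | inj₂ eq | inj₂ refl = inj₁ (cong proj₁ (sym eq))

  edge-injective : ∀ {e f} → edge e ≡ edge f → e ≡ f
  edge-injective eq = trans (sym (strictlyInverseʳ edges _)) (trans (cong (from edges) eq) (strictlyInverseʳ edges _))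

  claw-map : ∀ {v e f g} → Claw G v e f g → Claw H (vertex v) (edge e) (edge f) (edge g)
  claw-map {e = e} {f} {g} c = record
    { incident₁  = incident-map e (incident₁ c)
    ; incident₂  = incident-map f (incident₂ c)
    ; incident₃  = incident-map g (incident₃ c)
    ; distinct₁₂ = distinct₁₂ c ∘ edge-injective
    ; distinct₁₃ = distinct₁₃ c ∘ edge-injective
    ; distinct₂₃ = distinct₂₃ c ∘ edge-injective
    }

  path-along : ∀ {P Q} → (∀ e → P e → Q (edge e)) → ∀ {u v} → Path G P u v → Path H Q (vertex u) (vertex v)
  path-along PQ = gmap vertex λ (e , p , j) → edge e , PQ e p , joins e _ _ j

-- `joins` maps forwards only; it can be reversed because an edge determines its ends up to order.
≅-sym : ∀ {G H} → G ≅ H → H ≅ G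
≅-sym {G} {H} φ = record { vertices = ↔-sym vertices ; edges = ↔-sym edges ; joins = back }
  where
  open _≅_ φ
  open Inverse
  joins-unique : ∀ {e u v x y} → Joins H e u v → Joins H e x y → (u ≡ x × v ≡ y) ⊎ (u ≡ y × v ≡ x)
  joins-unique (inj₁ p) (inj₁ q) with refl ← trans (sym p) q = inj₁ (refl , refl)
  joins-unique (inj₁ p) (inj₂ q) with refl ← trans (sym p) q = inj₂ (refl , refl)
  joins-unique (inj₂ p) (inj₁ q) with refl ← trans (sym p) q = inj₂ (refl , refl)
  joins-unique (inj₂ p) (inj₂ q) with refl ← trans (sym p) q = inj₁ (refl , refl)
  pull : ∀ {v w} → to vertices v ≡ w → v ≡ from vertices w
  pull eq = trans (sym (strictlyInverseʳ vertices _)) (cong (from vertices) eq)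
  back : ∀ e u v → Joins H e u v → Joins G (from edges e) (from vertices u) (from vertices v)
  back e u v p with joins-unique
    (subst (λ f → Joins H f (to vertices (proj₁ (ends G (from edges e)))) (to vertices (proj₂ (ends G (from edges e)))))
      (strictlyInverseˡ edges e) (joins (from edges e) _ _ (inj₁ refl))) p
  ... | inj₁ (a , b) = inj₁ (cong₂ _,_ (pull a) (pull b))
  ... | inj₂ (a , b) = inj₂ (cong₂ _,_ (pull a) (pull b))

bridgeless-≅ : ∀ {G H} → G ≅ H → Bridgeless G → Bridgeless H
bridgeless-≅ {G} {H} φ (connected , bridgeless) =
  (λ u v → subst₂ (Path H _) (onto u) (onto v) (path-along (λ _ _ → tt) (connected (from vertices u) (from vertices v))))
  , λ e u v → subst₂ (Path H _) (onto u) (onto v)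
      (path-along (λ { f f≢ refl → f≢ (sym (strictlyInverseʳ edges f)) })
        (bridgeless (from edges e) (from vertices u) (from vertices v)))
  where
  open _≅_ φ
  open Inverse
  open Isomorphism φ
  onto : ∀ u → to vertices (from vertices u) ≡ u
  onto = strictlyInverseˡ vertices

module _ {G H : Graph} (φ : G ≅ H) where

  open _≅_ φ
  open Inverse
  private
    module F = Isomorphism φ
    module B = Isomorphism (≅-sym φ)

  cubic-≅ : Cubic G → Cubic H
  cubic-≅ cubic v = ↔-trans (mk↔ₛ′
    (λ (e , p) → from edges e , B.incident-map e p)
    (λ (e , p) → to edges e , subst (λ w → Incident H w (to edges e)) (strictlyInverseˡ vertices v) (F.incident-map e p))
    (λ (e , p) → incident-pair G (strictlyInverseʳ edges e) _ _)
    (λ (e , p) → incident-pair H (strictlyInverseˡ edges e) _ _))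
    (cubic (from vertices v))

  matching-≅ : ∀ {M} → PerfectMatching G M → PerfectMatching H (M ∘ from edges)
  matching-≅ {M} matching v with e , (Me , p) , unique ← matching (from vertices v) =
    to edges e
    , (subst (T ∘ M) (sym (strictlyInverseʳ edges e)) Me
      , subst (λ w → Incident H w (to edges e)) (strictlyInverseˡ vertices v) (F.incident-map e p))
    , λ {f} (Mf , q) → trans (cong (to edges) (unique (Mf , B.incident-map f q))) (strictlyInverseˡ edges f)

  module _ (cubicᴳ : Cubic G) (cubicᴴ : Cubic H) where

    -- Parities are compared on a claw and its image, so no sum has to be reindexed.
    odd-≅ : ∀ f → Odd G f → Odd H (f ∘ from edges)
    odd-≅ f odd v = let e₁ , e₂ , e₃ , c = claw-at H cubicᴴ v in begin
      parity H (f ∘ from edges) v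
        ≡⟨ parity-claw H cubicᴴ (f ∘ from edges) c ⟩
      f (from edges e₁) xor (f (from edges e₂) xor f (from edges e₃))
        ≡⟨ parity-claw G cubicᴳ f (B.claw-map c) ⟨
      parity G f (from vertices v)
        ≡⟨ odd (from vertices v) ⟩
      true ∎
      where open ≡-Reasoning

    -- Moving colour sets instead of colourings spares an isomorphism between the graphs with added
    -- parallel edges.
    colourSets-≅ : ∀ {M t} → ColourSets G M t → ColourSets H (M ∘ from edges) t
    colourSets-≅ C = record
      { colours = λ e → ColourSets.colours C (from edges e)
      ; odd     = λ a → odd-≅ (λ e → ColourSets.colours C e a) (ColourSets.odd C a)
      ; shape   = λ e → ColourSets.shape C (from edges e)
      }

theorem5p6 : (G : Graph) → TreelikeSnark G → Frumious G
theorem5p6 G S = bridgelessᴳ , cubic , not-classI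
  where
  open TreelikeSnark S
  X : Graph
  X = treelike halin poles
  frumiousᴾ : ∀ x → Frumious (closure (poles x))
  frumiousᴾ x = proj₁ (frumious x)
  cubicˣ : Cubic X
  cubicˣ = cubic-≅ iso cubic
  bridgelessᴳ : Bridgeless G
  bridgelessᴳ = bridgeless-≅ {X} {G} (≅-sym {G} {X} iso)
    (treelike-bridgeless halin poles (λ x → proj₁ (frumiousᴾ x)))
  not-classI : ∀ M → PerfectMatching G M → l≡∞ G M
  not-classI M matching t classI =
    treelike-not-coloured halin poles cubicˣ frumiousᴾ {M ∘ Inverse.from (_≅_.edges iso)} matchingˣ {t} coloursˣ
    where
    matchingˣ : PerfectMatching X (M ∘ Inverse.from (_≅_.edges iso))
    matchingˣ = matching-≅ {G} {X} iso {M} matching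
    coloursˣ : ColourSets X (M ∘ Inverse.from (_≅_.edges iso)) t
    coloursˣ = colourSets-≅ {G} {X} iso cubic cubicˣ {M} {t}
      (colourable⇒colourSets G cubic M matching t (classI⇒colourable G cubic M matching t classI))
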